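{- For every single-valued pointed problem $F:\subseteq\mathbb N^{\mathbb N}\to\mathbb N^{\mathbb N}$ we have $F^\infty\equiv_{\mathrm{sW}}F^\omega\equiv_{\mathrm{sW}}\widehat{F^\diamond}$.
   Context: Problems. A partial function $F:\subseteq\mathbb N^{\mathbb N}\to\mathbb N^{\mathbb N}$ is computable if there is a computable monotone (w.r.t. the prefix order) word function $\varphi:\mathbb N^*\to\mathbb N^*$ with $F(p)=\sup_{w\sqsubseteq p}\varphi(w)$ for all $p\in\mathrm{dom}(F)$. For represented spaces $(X,\delta_X),(Y,\delta_Y)$ ($\delta_X:\subseteq\mathbb N^{\mathbb N}\to X$ surjective) and a partial multivalued $f:\subseteq X\rightrightarrows Y$, $F:\subseteq\mathbb N^{\mathbb N}\to\mathbb N^{\mathbb N}$ is a realizer, $F\vdash f$, if $\delta_YF(p)\in f\delta_X(p)$ for all $p\in\mathrm{dom}(f\delta_X)$. A problem is a multivalued function with a realizer. Composition: $g\circ f(x)=\{z:(\exists y\in f(x))\,z\in g(y)\}$ with $\mathrm{dom}(g\circ f)=\{x\in\mathrm{dom}(f):f(x)\subseteq\mathrm{dom}(g)\}$. Tupling. $\langle q,p\rangle:=q(0)p(0)q(1)p(1)\dots$; $\langle p_0,p_1,\dots\rangle$ is the standard countable tupling, e.g. $\langle p_0,p_1,\dots\rangle(\langle i,j\rangle)=p_i(j)$, and $\langle q_0,\dots,q_k\rangle$ is a standard finite tupling. $\langle\mathrm{id}\times f\rangle$ is the problem $\langle q,p\rangle\mapsto\{\langle q,r\rangle:r\in f(p)\}$.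 Universal function. $\Phi$ is a fixed standard total representation of a set of continuous partial functions on $\mathbb N^{\mathbb N}$ (with natural domains), where a name $q$ encodes the graph of a monotone word function approximating $\Phi_q$; $\mathsf U_q:=\Phi_q$, and $\mathsf U\langle q,p\rangle:=\mathsf U_q(p)$ is a computable partial function. The smn-theorem holds: for every computable (continuous) $F:\subseteq\mathbb N^{\mathbb N}\to\mathbb N^{\mathbb N}$ there is a total computable (continuous) $S$ with $\mathsf U_{S(q)}(p)=F\langle q,p\rangle$ for all $\langle q,p\rangle\in\mathrm{dom}(F)$. The names $q$ allow the digits $0,1,2$ as dummy symbols: adding or removing them does not change $\mathsf U_q$. Operators, for $f:\subseteq\mathbb N^{\mathbb N}\rightrightarrows\mathbb N^{\mathbb N}$. Put $L_f:=\mathsf U\circ\langle\mathrm{id}\times f\rangle$. Infinite loop: $f^\infty(q_0):=\{\langle q_0,q_1,\dots\rangle:(\forall i)\ q_{i+1}\in L_f(q_i)\}$, with $\mathrm{dom}(f^\infty)$ the set of $q_0$ such that $A_0:=\{q_0\}\subseteq\mathrm{dom}(L_f)$ and $A_{i+1}:=L_f(A_i)\subseteq\mathrm{dom}(L_f)$ for all $i$. Diamond: a finite run is $\langle q_0,\dots,q_k\rangle$ with $q_{i+1}\in L_f(q_i)$ for all $i<k$; an infinite run is $\langle q_0,q_1,\dots\rangle$ with this for all $i$. A finite run is successful if $q_k(0)=0$ and $q_i(0)\ne0$ for all $i<k$; it stalls if $q_k\notin\mathrm{dom}(L_f)$ and $q_i(0)\ne0$ for all $i\le k$; an infinite run is unsuccessful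 if $q_i(0)\ne0$ for all $i$. $f^\diamond(q_0)$ is the set of all $q_k$ such that there are $q_1,\dots,q_{k-1}$ with $\langle q_0,\dots,q_k\rangle$ a successful finite run; $\mathrm{dom}(f^\diamond)$ is the set of $q_0$ such that no run starting with $q_0$ stalls or is infinite and unsuccessful. Omega: $f^{[0]}:=\mathrm{id}$, $f^{[1]}:=\langle\mathrm{id}\times f\rangle$, $f^{[n+1]}:=\langle\mathrm{id}\times f\rangle\circ\mathsf U\circ f^{[n]}$ for $n\ge1$, and $f^\omega(p):=\langle f^{[0]}(p),f^{[1]}(p),f^{[2]}(p),\dots\rangle=\{\langle r_0,r_1,\dots\rangle:(\forall n)\ r_n\in f^{[n]}(p)\}$ for all $p$ with $p\in\mathrm{dom}(f^{[n]})$ for all $n$. Parallelization: for $g:\subseteq X\rightrightarrows Y$, $\widehat g:\subseteq X^{\mathbb N}\rightrightarrows Y^{\mathbb N}$, $(x_i)_i\mapsto\prod_ig(x_i)$. Reducibilities. $f\le_{\mathrm W}g$ if there are computable $H,K:\subseteq\mathbb N^{\mathbb N}\to\mathbb N^{\mathbb N}$ with $H\langle\mathrm{id},GK\rangle\vdash f$ whenever $G\vdash g$; $f\le_{\mathrm{sW}}g$ if there are computable $H,K$ with $HGK\vdash f$ whenever $G\vdash g$; $\equiv_{\mathrm{sW}}$ is the induced equivalence. A problem $f$ is pointed if $\mathrm{id}\le_{\mathrm W}f$ for the identity $\mathrm{id}$ on $\mathbb N^{\mathbb N}$, i.e. if $f$ has a computable input. -}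

module Defs where

open import Data.Fin using (Fin; fromℕ; inject₁) renaming (zero to fzero; suc to fsuc)
open import Data.List using (List; []; _∷_; length; foldr)
open import Data.List.Relation.Binary.Prefix.Heterogeneous using (Prefix)
open import Data.Nat using (ℕ; zero; suc; _+_; _<_; s≤s)
open import Data.Nat.Properties using (+-identityʳ; +-suc)
open import Data.Product using (Σ; ∃; ∃-syntax; _×_; _,_; proj₁; proj₂)
open import Data.Unit using (⊤; tt)
open import Function using (id; _∘_)
open import Level using (0ℓ)
open import Relation.Binary.Bundles using (Setoid)
open import Relation.Binary.PropositionalEquality
  using (_≡_; _≢_; _≗_; refl; sym; trans; cong; _→-setoid_)
open import Relation.Nullary using (¬_)

------------------------------------------------------------------------
-- Computable functions on finite data

data Type : Set where
  nat   : Type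
  _⊗_   : Type → Type → Type
  list  : Type → Type

⟦_⟧ : Type → Set
⟦ nat ⟧    = ℕ
⟦ A ⊗ B ⟧  = ⟦ A ⟧ × ⟦ B ⟧
⟦ list A ⟧ = List ⟦ A ⟧

primrec : {A B : Set} → (A → B) → ((A × ℕ) × B → B) → A × ℕ → B
primrec g h (a , zero)  = g a
primrec g h (a , suc n) = h ((a , n) , primrec g h (a , n))

listrec : {A B C : Set} → (A → B) → ((A × C) × B → B) → A × List C → B
listrec g h (a , cs) = foldr (λ c b → h ((a , c) , b)) (g a) cs

-- The total recursive functions in Kleene's form: the least class containing
-- the basic functions and closed under composition, primitive recursion and
-- minimisation of regular functions.  Pairs and lists are primitive data
-- here, so that words need no coding by numbers.
data Computable : {A B : Type} → (⟦ A ⟧ → ⟦ B ⟧) → Set where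
  ext    : ∀ {A B} {f g : ⟦ A ⟧ → ⟦ B ⟧} → f ≗ g →
           Computable {A} {B} f → Computable {A} {B} g
  ident  : ∀ {A} → Computable {A} {A} id
  comp   : ∀ {A B C} {f : ⟦ A ⟧ → ⟦ B ⟧} {g : ⟦ B ⟧ → ⟦ C ⟧} →
           Computable {B} {C} g → Computable {A} {B} f →
           Computable {A} {C} (g ∘ f)
  fst    : ∀ {A B} → Computable {A ⊗ B} {A} proj₁
  snd    : ∀ {A B} → Computable {A ⊗ B} {B} proj₂
  pairing : ∀ {A B C} {f : ⟦ A ⟧ → ⟦ B ⟧} {g : ⟦ A ⟧ → ⟦ C ⟧} →
           Computable {A} {B} f → Computable {A} {C} g →
           Computable {A} {B ⊗ C} (λ a → f a , g a)
  zer    : ∀ {A} → Computable {A} {nat} (λ _ → 0)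
  succ   : Computable {nat} {nat} suc
  natrec : ∀ {A B} {g : ⟦ A ⟧ → ⟦ B ⟧} {h : (⟦ A ⟧ × ℕ) × ⟦ B ⟧ → ⟦ B ⟧} →
           Computable {A} {B} g → Computable {(A ⊗ nat) ⊗ B} {B} h →
           Computable {A ⊗ nat} {B} (primrec g h)
  nil    : ∀ {A C} → Computable {A} {list C} (λ _ → [])
  cons   : ∀ {C} → Computable {C ⊗ list C} {list C} (λ (c , cs) → c ∷ cs)
  fold   : ∀ {A B C} {g : ⟦ A ⟧ → ⟦ B ⟧} {h : (⟦ A ⟧ × ⟦ C ⟧) × ⟦ B ⟧ → ⟦ B ⟧} →
           Computable {A} {B} g → Computable {(A ⊗ C) ⊗ B} {B} h →
           Computable {A ⊗ list C} {B} (listrec g h)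
  minim  : ∀ {A} {f : ⟦ A ⟧ × ℕ → ℕ} {m : ⟦ A ⟧ → ℕ} →
           Computable {A ⊗ nat} {nat} f →
           (∀ a → f (a , m a) ≡ 0) →
           (∀ a k → k < m a → f (a , k) ≢ 0) →
           Computable {A} {nat} m

------------------------------------------------------------------------
-- Words and Baire space

Word : Set
Word = List ℕ

-- Points of Baire space are compared by _≗_, and every notion below respects
-- this equality.
Baire : Set
Baire = ℕ → ℕ

infix 4 _⊑_ _⊏_

_⊑_ : Word → Word → Set
_⊑_ = Prefix _≡_

data _⊏_ : Word → Baire → Set where
  []  : ∀ {p} → [] ⊏ p
  _∷_ : ∀ {a w p} → a ≡ p 0 → w ⊏ (p ∘ suc) → (a ∷ w) ⊏ p

-- The supremum of S in the prefix order on ℕ* ∪ ℕ^ℕ exists and is the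
-- infinite sequence r.
IsSup : (Word → Set) → Baire → Set
IsSup S r = (∀ v → S v → v ⊏ r) × (∀ n → ∃[ v ] S v × n < length v)

⊏-cong : ∀ {w p p′} → p ≗ p′ → w ⊏ p → w ⊏ p′
⊏-cong e []      = []
⊏-cong e (x ∷ d) = trans x (e 0) ∷ ⊏-cong (e ∘ suc) d

⊏-agree : ∀ {w p p′ n} → w ⊏ p → w ⊏ p′ → n < length w → p n ≡ p′ n
⊏-agree {n = zero}  (x ∷ _) (y ∷ _) _       = trans (sym x) y
⊏-agree {n = suc n} (_ ∷ d) (_ ∷ e) (s≤s l) = ⊏-agree d e l

IsSup-cong : ∀ {S T : Word → Set} {r r′} → (∀ v → S v → T v) → (∀ v → T v → S v) →
             r ≗ r′ → IsSup S r → IsSup T r′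
IsSup-cong S⊆T T⊆S e (ub , len) =
  (λ v t → ⊏-cong e (ub v (T⊆S v t))) ,
  (λ n → let (v , s , l) = len n in v , S⊆T v s , l)

IsSup-unique : ∀ {S r r′} → IsSup S r → IsSup S r′ → r ≗ r′
IsSup-unique (ub , len) (ub′ , _) n =
  let (v , s , l) = len n in ⊏-agree (ub v s) (ub′ v s) l

-- q(0)p(0)q(1)p(1)…
⟨_,_⟩ : Baire → Baire → Baire
⟨ q , p ⟩ zero    = q 0
⟨ q , p ⟩ (suc n) = ⟨ p , q ∘ suc ⟩ n

evens : Baire → Baire
evens s n = s (n + n)

odds : Baire → Baire
odds s n = s (suc (n + n))

⟨,⟩-cong : ∀ {q q′ p p′} → q ≗ q′ → p ≗ p′ → ⟨ q , p ⟩ ≗ ⟨ q′ , p′ ⟩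
⟨,⟩-cong d e zero    = d 0
⟨,⟩-cong d e (suc n) = ⟨,⟩-cong e (d ∘ suc) n

evens-⟨,⟩ : ∀ q p → evens ⟨ q , p ⟩ ≗ q
odds-⟨,⟩  : ∀ q p → odds ⟨ q , p ⟩ ≗ p
evens-⟨,⟩ q p zero    = refl
evens-⟨,⟩ q p (suc n) = trans (cong ⟨ p , q ∘ suc ⟩ (+-suc n n)) (evens-⟨,⟩ (q ∘ suc) (p ∘ suc) n)
odds-⟨,⟩ q p n = evens-⟨,⟩ p (q ∘ suc) n

-- Cantor pairing on ℕ, and its inverse, which walks along the diagonals.
triangle : ℕ → ℕ
triangle zero    = 0
triangle (suc n) = suc n + triangle n

pair : ℕ → ℕ → ℕ
pair i j = j + triangle (i + j)

next : ℕ × ℕ → ℕ × ℕ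
next (zero  , j) = suc j , 0
next (suc i , j) = i , suc j

unpair : ℕ → ℕ × ℕ
unpair zero    = 0 , 0
unpair (suc n) = next (unpair n)

unpair-pair : ∀ i j → unpair (pair i j) ≡ (i , j)
unpair-pair i j = onDiagonal (i + j) i j refl
  where
  onDiagonal : ∀ s i j → i + j ≡ s → unpair (j + triangle s) ≡ (i , j)
  onDiagonal s i (suc j) e =
    cong next (onDiagonal s (suc i) j (trans (sym (+-suc i j)) e))
  onDiagonal zero    zero    zero _  = refl
  onDiagonal (suc s) (suc i) zero e with trans (sym (+-identityʳ (suc i))) e
  ... | refl = cong next (onDiagonal s zero s refl)

-- ⟨p₀,p₁,…⟩
tuple : (ℕ → Baire) → Baire
tuple p n = let (i , j) = unpair n in p i j

component : ℕ → Baire → Baire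
component i s j = s (pair i j)

tuple-pair : ∀ p i j → tuple p (pair i j) ≡ p i j
tuple-pair p i j = cong (λ (k , l) → p k l) (unpair-pair i j)

codeWord : Word → ℕ
codeWord []      = 0
codeWord (a ∷ w) = suc (pair a (codeWord w))

------------------------------------------------------------------------
-- Partial functions on Baire space

record PartialFunction : Set₁ where
  field
    graph        : Baire → Baire → Set
    graph-cong   : ∀ {p p′ r r′} → p ≗ p′ → r ≗ r′ → graph p r → graph p′ r′
    graph-unique : ∀ {p r r′} → graph p r → graph p r′ → r ≗ r′

open PartialFunction public

infixr 9 _∘ᵖ_

_∘ᵖ_ : PartialFunction → PartialFunction → PartialFunction
(G ∘ᵖ F) .graph p r = ∃[ q ] graph F p q × graph G q r
(G ∘ᵖ F) .graph-cong d e (q , x , y) =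
  q , graph-cong F d (λ _ → refl) x , graph-cong G (λ _ → refl) e y
(G ∘ᵖ F) .graph-unique (q , x , y) (q′ , x′ , y′) =
  graph-unique G y (graph-cong G (graph-unique F x′ x) (λ _ → refl) y′)

⟨id,_⟩ : PartialFunction → PartialFunction
⟨id, G ⟩ .graph p s = ∃[ r ] graph G p r × s ≗ ⟨ p , r ⟩
⟨id, G ⟩ .graph-cong d e (r , x , y) =
  r , graph-cong G d (λ _ → refl) x ,
  λ n → trans (sym (e n)) (trans (y n) (⟨,⟩-cong d (λ _ → refl) n))
⟨id, G ⟩ .graph-unique (r , x , y) (r′ , x′ , y′) n =
  trans (y n) (trans (⟨,⟩-cong (λ _ → refl) (graph-unique G x x′) n) (sym (y′ n)))

IsComputable : PartialFunction → Set
IsComputable F =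
  Σ (Word → Word) λ φ →
    Computable {list nat} {list nat} φ ×
    (∀ {v w} → v ⊑ w → φ v ⊑ φ w) ×
    (∀ p r → graph F p r → IsSup (λ v → ∃[ w ] w ⊏ p × v ≡ φ w) r)

------------------------------------------------------------------------
-- The universal function

-- A digit n ≥ 3 of a name stands for the pair of words with code n - 3; the
-- digits 0, 1, 2 are ignored.
_Lists_↦_ : Baire → Word → Word → Set
q Lists u ↦ v = ∃[ i ] q i ≡ 3 + pair (codeWord u) (codeWord v)

-- The listed pairs generate the monotone word function which sends w to the
-- supremum of all v listed with some prefix u of w.  Every q is a name; where
-- the listed words contradict each other along p, or have bounded length,
-- Φ q is undefined at p.
Φ : Baire → Baire → Baire → Set
Φ q p = IsSup (λ v → ∃[ u ] u ⊏ p × q Lists u ↦ v)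

Φ-cong : ∀ {q q′ p p′ r r′} → q ≗ q′ → p ≗ p′ → r ≗ r′ → Φ q p r → Φ q′ p′ r′
Φ-cong {q} {q′} {p} {p′} c d =
  IsSup-cong
    (λ v (u , a , i , x) → u , ⊏-cong d a , i , trans (sym (c i)) x)
    (λ v (u , a , i , x) → u , ⊏-cong (sym ∘ d) a , i , trans (c i) x)

𝖴 : PartialFunction
𝖴 .graph s = Φ (evens s) (odds s)
𝖴 .graph-cong d = Φ-cong (λ n → d (n + n)) (λ n → d (suc (n + n)))
𝖴 .graph-unique = IsSup-unique

------------------------------------------------------------------------
-- Represented spaces, multivalued functions and reducibility

record RepresentedSpace : Set₁ where
  field
    setoid : Setoid 0ℓ 0ℓ
  open Setoid setoid public using (Carrier; _≈_)
  field
    δ            : Baire → Carrier → Set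
    δ-cong       : ∀ {p p′ x x′} → p ≗ p′ → x ≈ x′ → δ p x → δ p′ x′
    δ-unique     : ∀ {p x x′} → δ p x → δ p x′ → x ≈ x′
    δ-surjective : ∀ x → ∃[ p ] δ p x

𝔹 : RepresentedSpace
𝔹 = record
  { setoid       = ℕ →-setoid ℕ
  ; δ            = _≗_
  ; δ-cong       = λ d e x n → trans (sym (d n)) (trans (x n) (e n))
  ; δ-unique     = λ x y n → trans (sym (x n)) (y n)
  ; δ-surjective = λ p → p , λ _ → refl
  }

_^ℕ : RepresentedSpace → RepresentedSpace
X ^ℕ = record
  { setoid = record
      { Carrier = ℕ → X.Carrier
      ; _≈_     = λ x y → ∀ i → x i X.≈ y i
      ; isEquivalence = record
          { refl  = λ _ → S.refl
          ; sym   = λ d i → S.sym (d i)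
          ; trans = λ d e i → S.trans (d i) (e i)
          }
      }
  ; δ            = λ p x → ∀ i → X.δ (component i p) (x i)
  ; δ-cong       = λ d e a i → X.δ-cong (λ j → d (pair i j)) (e i) (a i)
  ; δ-unique     = λ a b i → X.δ-unique (a i) (b i)
  ; δ-surjective = λ x →
      tuple (name x) ,
      λ i → X.δ-cong (λ j → sym (tuple-pair (name x) i j)) S.refl (proj₂ (X.δ-surjective (x i)))
  }
  where
  module X = RepresentedSpace X
  module S = Setoid X.setoid
  name : (ℕ → X.Carrier) → ℕ → Baire
  name x i = proj₁ (X.δ-surjective (x i))

infix 3 _⇉_

record _⇉_ (X Y : RepresentedSpace) : Set₁ where
  private
    module X = RepresentedSpace X
    module Y = RepresentedSpace Y
  field
    dom      : X.Carrier → Set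
    val      : X.Carrier → Y.Carrier → Set
    dom-cong : ∀ {x x′} → x X.≈ x′ → dom x → dom x′
    val-cong : ∀ {x x′ y y′} → x X.≈ x′ → y Y.≈ y′ → val x y → val x′ y′
    val⇒dom  : ∀ {x y} → val x y → dom x

open _⇉_ public

module _ {X Y : RepresentedSpace} where
  private
    module X = RepresentedSpace X
    module Y = RepresentedSpace Y

  infix 4 _⊢_

  _⊢_ : PartialFunction → X ⇉ Y → Set
  F ⊢ f = ∀ p x → X.δ p x → dom f x →
          ∃[ r ] graph F p r × ∃[ y ] Y.δ r y × val f x y

  -- In particular f x is then inhabited for every x in dom f.
  IsProblem : X ⇉ Y → Set₁
  IsProblem f = Σ PartialFunction λ F → F ⊢ f

  SingleValued : X ⇉ Y → Set
  SingleValued f = ∀ {x y y′} → val f x y → val f x y′ → y Y.≈ y′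

module _ {X Y Z W : RepresentedSpace} where

  infix 4 _≤W_ _≤sW_

  _≤W_ : X ⇉ Y → Z ⇉ W → Set₁
  f ≤W g = Σ PartialFunction λ H → Σ PartialFunction λ K →
    IsComputable H × IsComputable K ×
    (∀ G → G ⊢ g → H ∘ᵖ ⟨id, G ∘ᵖ K ⟩ ⊢ f)

  _≤sW_ : X ⇉ Y → Z ⇉ W → Set₁
  f ≤sW g = Σ PartialFunction λ H → Σ PartialFunction λ K →
    IsComputable H × IsComputable K ×
    (∀ G → G ⊢ g → H ∘ᵖ G ∘ᵖ K ⊢ f)

infix 4 _≡sW_

_≡sW_ : ∀ {X Y Z W} → X ⇉ Y → Z ⇉ W → Set₁
f ≡sW g = f ≤sW g × g ≤sW f

infixr 9 _∘ᵐ_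

_∘ᵐ_ : ∀ {X Y Z} → Y ⇉ Z → X ⇉ Y → X ⇉ Z
_∘ᵐ_ {X} {Y} {Z} g f = record
  { dom      = D
  ; val      = λ x z → D x × ∃[ y ] val f x y × val g y z
  ; dom-cong = D-cong
  ; val-cong = λ { d e (a , y , b , c) →
      D-cong d a , y , val-cong f d Y.refl b , val-cong g Y.refl e c }
  ; val⇒dom  = proj₁
  }
  where
  module X = Setoid (RepresentedSpace.setoid X)
  module Y = Setoid (RepresentedSpace.setoid Y)
  D : X.Carrier → Set
  D x = dom f x × (∀ y → val f x y → dom g y)
  D-cong : ∀ {x x′} → x X.≈ x′ → D x → D x′
  D-cong d (a , b) =
    dom-cong f d a , λ y c → b y (val-cong f (X.sym d) Y.refl c)

multi : PartialFunction → 𝔹 ⇉ 𝔹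
multi F = record
  { dom      = λ p → ∃[ r ] graph F p r
  ; val      = graph F
  ; dom-cong = λ { d (r , x) → r , graph-cong F d (λ _ → refl) x }
  ; val-cong = graph-cong F
  ; val⇒dom  = λ {_} {r} x → r , x
  }

idᵐ : 𝔹 ⇉ 𝔹
idᵐ = record
  { dom      = λ _ → ⊤
  ; val      = _≗_
  ; dom-cong = λ _ _ → tt
  ; val-cong = RepresentedSpace.δ-cong 𝔹
  ; val⇒dom  = λ _ → tt
  }

Pointed : ∀ {X Y} → X ⇉ Y → Set₁
Pointed f = idᵐ ≤W f

------------------------------------------------------------------------
-- The operators

⟨id×_⟩ : 𝔹 ⇉ 𝔹 → 𝔹 ⇉ 𝔹
⟨id× f ⟩ = record
  { dom      = λ s → dom f (odds s)
  ; val      = λ s t → ∃[ r ] val f (odds s) r × t ≗ ⟨ evens s , r ⟩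
  ; dom-cong = λ d → dom-cong f (λ n → d (suc (n + n)))
  ; val-cong = λ { d e (r , x , y) →
      r , val-cong f (λ n → d (suc (n + n))) (λ _ → refl) x ,
      λ n → trans (sym (e n)) (trans (y n) (⟨,⟩-cong (λ m → d (m + m)) (λ _ → refl) n)) }
  ; val⇒dom  = λ { (_ , x , _) → val⇒dom f x }
  }

L : 𝔹 ⇉ 𝔹 → 𝔹 ⇉ 𝔹
L f = multi 𝖴 ∘ᵐ ⟨id× f ⟩

IsInfiniteRun : 𝔹 ⇉ 𝔹 → (ℕ → Baire) → Set
IsInfiniteRun f q = ∀ i → val (L f) (q i) (q (suc i))

module _ (f : 𝔹 ⇉ 𝔹) where

  -- Reach q₀ i is the set A_i.
  Reach : Baire → ℕ → Baire → Set
  Reach q₀ zero    q = q ≗ q₀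
  Reach q₀ (suc i) q = ∃[ p ] Reach q₀ i p × val (L f) p q

  private
    D : Baire → Set
    D q₀ = ∀ i q → Reach q₀ i q → dom (L f) q

    Reach-cong : ∀ {p p′} i {q} → p ≗ p′ → Reach p i q → Reach p′ i q
    Reach-cong zero    d e           n = trans (e n) (d n)
    Reach-cong (suc i) d (q , a , b)   = q , Reach-cong i d a , b

    D-cong : ∀ {p p′} → p ≗ p′ → D p → D p′
    D-cong d a i q b = a i q (Reach-cong i (sym ∘ d) b)

  infixl 20 _^∞

  _^∞ : 𝔹 ⇉ 𝔹
  _^∞ = record
    { dom      = D
    ; val      = λ q₀ s → D q₀ ×
        ∃[ q ] q 0 ≗ q₀ × IsInfiniteRun f q × s ≗ tuple q
    ; dom-cong = D-cong
    ; val-cong = λ { d e (a , q , b , c , x) →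
        D-cong d a , q , (λ n → trans (b n) (d n)) , c ,
        λ n → trans (sym (e n)) (x n) }
    ; val⇒dom  = proj₁
    }

IsFiniteRun : 𝔹 ⇉ 𝔹 → (k : ℕ) → (Fin (suc k) → Baire) → Set
IsFiniteRun f k q = ∀ (i : Fin k) → val (L f) (q (inject₁ i)) (q (fsuc i))

IsSuccessful : (k : ℕ) → (Fin (suc k) → Baire) → Set
IsSuccessful k q = q (fromℕ k) 0 ≡ 0 × (∀ (i : Fin k) → q (inject₁ i) 0 ≢ 0)

Stalls : 𝔹 ⇉ 𝔹 → (k : ℕ) → (Fin (suc k) → Baire) → Set
Stalls f k q = ¬ dom (L f) (q (fromℕ k)) × (∀ i → q i 0 ≢ 0)

IsUnsuccessful : (ℕ → Baire) → Set
IsUnsuccessful q = ∀ i → q i 0 ≢ 0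

-- The domain forbids failing runs; that it then contains the start of some
-- successful run is a consequence only in classical logic.
module _ (f : 𝔹 ⇉ 𝔹) where

  private
    D : Baire → Set
    D q₀ =
      (∀ k q → q fzero ≗ q₀ → IsFiniteRun f k q → ¬ Stalls f k q) ×
      (∀ q → q 0 ≗ q₀ → IsInfiniteRun f q → ¬ IsUnsuccessful q)

    D-cong : ∀ {p p′} → p ≗ p′ → D p → D p′
    D-cong d (a , b) =
      (λ k q e → a k q (λ n → trans (e n) (sym (d n)))) ,
      (λ q e → b q (λ n → trans (e n) (sym (d n))))

  infixl 20 _^◇

  _^◇ : 𝔹 ⇉ 𝔹
  _^◇ = record
    { dom      = D
    ; val      = λ q₀ r → D q₀ ×
        ∃[ k ] Σ (Fin (suc k) → Baire) λ q →
          q fzero ≗ q₀ × IsFiniteRun f k q × IsSuccessful k q × r ≗ q (fromℕ k)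
    ; dom-cong = D-cong
    ; val-cong = λ { d e (a , k , q , b , c , s , x) →
        D-cong d a , k , q , (λ n → trans (b n) (d n)) , c , s ,
        λ n → trans (sym (e n)) (x n) }
    ; val⇒dom  = proj₁
    }

infixl 20 _^[_]

_^[_] : 𝔹 ⇉ 𝔹 → ℕ → 𝔹 ⇉ 𝔹
f ^[ 0 ]           = idᵐ
f ^[ 1 ]           = ⟨id× f ⟩
f ^[ suc (suc n) ] = ⟨id× f ⟩ ∘ᵐ multi 𝖴 ∘ᵐ f ^[ suc n ]

infixl 20 _^ω

_^ω : 𝔹 ⇉ 𝔹 → 𝔹 ⇉ 𝔹
f ^ω = record
  { dom      = D
  ; val      = λ p s → D p ×
      ∃[ r ] (∀ n → val (f ^[ n ]) p (r n)) × s ≗ tuple r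
  ; dom-cong = D-cong
  ; val-cong = λ { d e (a , r , b , x) →
      D-cong d a , r , (λ n → val-cong (f ^[ n ]) d (λ _ → refl) (b n)) ,
      λ n → trans (sym (e n)) (x n) }
  ; val⇒dom  = proj₁
  }
  where
  D : Baire → Set
  D p = ∀ n → dom (f ^[ n ]) p
  D-cong : ∀ {p p′} → p ≗ p′ → D p → D p′
  D-cong d a n = dom-cong (f ^[ n ]) d (a n)

parallelization : ∀ {X Y} → X ⇉ Y → X ^ℕ ⇉ Y ^ℕ
parallelization g = record
  { dom      = λ x → ∀ i → dom g (x i)
  ; val      = λ x y → ∀ i → val g (x i) (y i)
  ; dom-cong = λ d a i → dom-cong g (d i) (a i)
  ; val-cong = λ d e a i → val-cong g (d i) (e i) (a i)
  ; val⇒dom  = λ a i → val⇒dom g (a i)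
  }

{-# OPTIONS --safe #-}
module Submission where

-- F ^∞ ≤ F ^ω ≤ parallelization (F ^◇) ≤ F ^∞.  The first reduction applies 𝖴 to
-- every entry of the output.  The other two turn a computation that asks F once in
-- each step into a run of the loop.  Its states carry the program which maps a
-- state and the answer of F to the next configuration; a configuration consists of
-- the name obtained by currying this program at the state, and of the next question
-- to F.  As names admit dummy digits, the state can be read off this name.
--
-- For F ^ω the n-th instance of F ^◇ is a countdown which makes n steps and then
-- halts.  Conversely, finitely many steps suffice for each instance of F ^◇, so a
-- single infinite loop can carry out all of these runs one after the other; the steps
-- which only pass to the next run ask F at a computable point of its domain.

open import Defs
open import Axiom.ExcludedMiddle using (ExcludedMiddle)
open import Data.Empty using (⊥-elim)
open import Data.Fin using (Fin; toℕ; fromℕ; fromℕ<; inject₁) renaming (zero to fzero; suc to fsuc)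
open import Data.Fin.Properties using (toℕ-fromℕ; toℕ-fromℕ<; toℕ-inject₁; toℕ<n)
open import Data.List using (List; []; _∷_; length; foldr; take; applyUpTo)
open import Data.List.Properties using (length-applyUpTo; take-all)
open import Data.List.Relation.Binary.Prefix.Heterogeneous using ([]; _∷_)
open import Data.Nat using (ℕ; zero; suc; pred; _+_; _∸_; _≤_; _<_; _⊔_; z≤n; s≤s)
open import Data.Nat.Properties
open import Data.Product using (Σ; ∃-syntax; _×_; _,_; proj₁; proj₂; uncurry)
open import Data.Sum using (inj₁; inj₂)
open import Data.Unit using (tt)
open import Function using (id; _∘_)
open import Level using (0ℓ)
open import Relation.Binary.Definitions using (tri<; tri≈; tri>)
open import Relation.Binary.PropositionalEquality
open import Relation.Nullary using (¬_; yes; no)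

-- Computable programs

-- The postprocessing of a strong reduction sees only the output, and one move of the loop hands on
-- nothing but what the current name computes from the answer of `F`. The name must therefore
-- transport the whole state, including the original input, in a form that can be decoded from the
-- output. Storing the program as data in the state also lets each step copy its own code, without
-- an appeal to the recursion theorem. Single-valuedness makes the loop deterministic, so that one
-- explicit run determines domains and values of all three operators. Excluded middle enters with
-- `F ^◇`: its domain only forbids failing runs, and a halting time has to be extracted from that.
-- The programs never use the halting times, which occur only in the proof of their correctness.

infix 4 _⇒_

record _⇒_ (A B : Type) : Set where
  field
    run        : ⟦ A ⟧ → ⟦ B ⟧
    computable : Computable {A} {B} run

open _⇒_

private variable
  A B C Γ : Type

-- Combinators rarely produce the function one wants to reason about; `ext` allows the readable one
-- to take its place.
withRun : (P : A ⇒ B) {f : ⟦ A ⟧ → ⟦ B ⟧} → run P ≗ f → A ⇒ B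
withRun P {f} e = record { run = f ; computable = ext e (computable P) }

infixr 9 _∘ᶜ_
infixr 4 _,ᶜ_

_∘ᶜ_ : B ⇒ C → A ⇒ B → A ⇒ C
P ∘ᶜ Q = record { run = run P ∘ run Q ; computable = comp (computable P) (computable Q) }

_,ᶜ_ : A ⇒ B → A ⇒ C → A ⇒ B ⊗ C
P ,ᶜ Q = record { run = λ a → run P a , run Q a ; computable = pairing (computable P) (computable Q) }

idᶜ : A ⇒ A
idᶜ = record { run = id ; computable = ident }

fstᶜ : A ⊗ B ⇒ A
fstᶜ = record { run = proj₁ ; computable = fst }

sndᶜ : A ⊗ B ⇒ B
sndᶜ = record { run = proj₂ ; computable = snd }

sucᶜ : Γ ⇒ nat → Γ ⇒ nat
sucᶜ P = record { run = suc ; computable = succ } ∘ᶜ P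

nilᶜ : Γ ⇒ list A
nilᶜ = record { run = λ _ → [] ; computable = nil }

consᶜ : Γ ⇒ A → Γ ⇒ list A → Γ ⇒ list A
consᶜ P Q = record { run = λ (c , cs) → c ∷ cs ; computable = cons } ∘ᶜ (P ,ᶜ Q)

constᶜ : ℕ → Γ ⇒ nat
constᶜ {Γ} n = record { run = λ _ → n ; computable = constant n }
  where
  constant : ∀ n → Computable {Γ} {nat} (λ _ → n)
  constant zero    = zer
  constant (suc n) = comp succ (constant n)

letᶜ : Γ ⇒ A → Γ ⊗ A ⇒ B → Γ ⇒ B
letᶜ P Q = Q ∘ᶜ (idᶜ ,ᶜ P)

recᶜ : Γ ⇒ B → (Γ ⊗ nat) ⊗ B ⇒ B → Γ ⇒ nat → Γ ⇒ B
recᶜ Z S N = record { run = primrec (run Z) (run S) ; computable = natrec (computable Z) (computable S) }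
  ∘ᶜ (idᶜ ,ᶜ N)

foldᶜ : Γ ⇒ B → (Γ ⊗ A) ⊗ B ⇒ B → Γ ⇒ list A → Γ ⇒ B
foldᶜ Z S W = record { run = listrec (run Z) (run S) ; computable = fold (computable Z) (computable S) }
  ∘ᶜ (idᶜ ,ᶜ W)

-- Variables of a context, counted from the right.
#0 : Γ ⊗ A ⇒ A
#0 = sndᶜ

#1 : (Γ ⊗ A) ⊗ B ⇒ A
#1 = sndᶜ ∘ᶜ fstᶜ

#2 : ((Γ ⊗ A) ⊗ B) ⊗ C ⇒ A
#2 = #1 ∘ᶜ fstᶜ

#3 : ∀ {D} → (((Γ ⊗ A) ⊗ B) ⊗ C) ⊗ D ⇒ A
#3 = #2 ∘ᶜ fstᶜ

caseℕ : {X : Set} → ℕ → X → (ℕ → X) → X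
caseℕ zero    z s = z
caseℕ (suc n) z s = s n

caseᶜ : Γ ⇒ nat → Γ ⇒ B → Γ ⊗ nat ⇒ B → Γ ⇒ B
caseᶜ {Γ} {B} N Z S = withRun (recᶜ Z (S ∘ᶜ fstᶜ) N)
  {λ γ → caseℕ (run N γ) (run Z γ) (λ n → run S (γ , n))} (λ γ → lemma γ (run N γ))
  where
  lemma : ∀ γ n → primrec (run Z) (run S ∘ proj₁) (γ , n) ≡ caseℕ n (run Z γ) (λ n → run S (γ , n))
  lemma γ zero    = refl
  lemma γ (suc n) = refl

predᶜ : Γ ⇒ nat → Γ ⇒ nat
predᶜ N = withRun (caseᶜ N (constᶜ 0) #0) (λ γ → lemma (run N γ))
  where
  lemma : ∀ n → caseℕ n 0 id ≡ pred n
  lemma zero    = refl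
  lemma (suc n) = refl

infixl 6 _+ᶜ_ _∸ᶜ_

_+ᶜ_ : Γ ⇒ nat → Γ ⇒ nat → Γ ⇒ nat
_+ᶜ_ {Γ} M N = withRun (recᶜ N (sucᶜ #0) M) (λ γ → lemma γ (run M γ))
  where
  lemma : ∀ γ m → primrec (run N) (suc ∘ proj₂) (γ , m) ≡ m + run N γ
  lemma γ zero    = refl
  lemma γ (suc m) = cong suc (lemma γ m)

_∸ᶜ_ : Γ ⇒ nat → Γ ⇒ nat → Γ ⇒ nat
_∸ᶜ_ {Γ} M N = withRun (recᶜ M (predᶜ #0) N) (λ γ → lemma γ (run N γ))
  where
  lemma : ∀ γ n → primrec (run M) (pred ∘ proj₂) (γ , n) ≡ run M γ ∸ n
  lemma γ zero    = refl
  lemma γ (suc n) = trans (cong pred (lemma γ n)) (pred[m∸n]≡m∸[1+n] (run M γ) n)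

pairᶜ : Γ ⇒ nat → Γ ⇒ nat → Γ ⇒ nat
pairᶜ {Γ} I J = withRun (J +ᶜ triangleᶜ (I +ᶜ J)) {λ γ → pair (run I γ) (run J γ)}
  (λ γ → cong (run J γ +_) (lemma (run I γ + run J γ)))
  where
  step : (Γ ⊗ nat) ⊗ nat ⇒ nat
  step = sucᶜ #1 +ᶜ #0
  triangleᶜ : Γ ⇒ nat → Γ ⇒ nat
  triangleᶜ = recᶜ (constᶜ 0) step
  lemma : ∀ {γ} n → primrec (λ _ → 0) (run step) (γ , n) ≡ triangle n
  lemma zero    = refl
  lemma (suc n) = cong (λ m → suc (n + m)) (lemma n)

unpairᶜ : Γ ⇒ nat → Γ ⇒ nat ⊗ nat
unpairᶜ {Γ} N = withRun (recᶜ (constᶜ 0 ,ᶜ constᶜ 0) step N) {λ γ → unpair (run N γ)} (λ γ → lemma (run N γ))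
  where
  step : (Γ ⊗ nat) ⊗ (nat ⊗ nat) ⇒ nat ⊗ nat
  step = caseᶜ (fstᶜ ∘ᶜ #0) (sucᶜ (sndᶜ ∘ᶜ #0) ,ᶜ constᶜ 0) (#0 ,ᶜ sucᶜ (sndᶜ ∘ᶜ #1))
  step-next : ∀ z {γ n} → run step ((γ , n) , z) ≡ next z
  step-next (zero  , j) = refl
  step-next (suc i , j) = refl
  lemma : ∀ {γ} n → primrec (λ _ → 0 , 0) (run step) (γ , n) ≡ unpair n
  lemma zero    = refl
  lemma {γ} (suc n) = trans (step-next (primrec (λ _ → 0 , 0) (run step) (γ , n)) {γ} {n}) (cong next (lemma n))

-- One of the two truncated differences is always 0, so this is the absolute difference; equality
-- becomes a test for 0, on which `caseᶜ` can branch.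
distance : ℕ → ℕ → ℕ
distance m n = (m ∸ n) + (n ∸ m)

distance≡0 : ∀ m n → distance m n ≡ 0 → m ≡ n
distance≡0 m n e = ≤-antisym (m∸n≡0⇒m≤n (m+n≡0⇒m≡0 (m ∸ n) e)) (m∸n≡0⇒m≤n (m+n≡0⇒n≡0 (m ∸ n) e))

distance-refl : ∀ n → distance n n ≡ 0
distance-refl n = cong₂ _+_ (n∸n≡0 n) (n∸n≡0 n)

distanceᶜ : Γ ⇒ nat → Γ ⇒ nat → Γ ⇒ nat
distanceᶜ M N = (M ∸ᶜ N) +ᶜ (N ∸ᶜ M)

-- Search (a result n is coded as suc n, and 0 means "undefined")

first : (ℕ → ℕ) → ℕ → ℕ
first f zero    = 0
first f (suc n) = caseℕ (first f n) (f n) suc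

firstᶜ : Γ ⊗ nat ⇒ nat → Γ ⇒ nat → Γ ⇒ nat
firstᶜ {Γ} F N = withRun (recᶜ (constᶜ 0) step N)
  {λ γ → first (λ j → run F (γ , j)) (run N γ)} (λ γ → lemma γ (run N γ))
  where
  step : (Γ ⊗ nat) ⊗ nat ⇒ nat
  step = caseᶜ #0 (F ∘ᶜ fstᶜ) (sucᶜ #0)
  lemma : ∀ γ n → primrec (λ _ → 0) (run step) (γ , n) ≡ first (λ j → run F (γ , j)) n
  lemma γ zero    = refl
  lemma γ (suc n) = cong (λ m → caseℕ m (run F (γ , n)) suc) (lemma γ n)

first-sound : ∀ f n {v} → first f n ≡ suc v → ∃[ j ] j < n × f j ≡ suc v
first-sound f (suc n) e with first f n in eq
... | zero  = n , n<1+n n , e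
... | suc _ = let (j , l , d) = first-sound f n (trans eq e) in j , m<n⇒m<1+n l , d

-- An earlier hit takes precedence in `first`, so enlarging the bound cannot change a value once
-- found. The monotonicity of `wordFunction` rests on this.
first-mono : ∀ f {m n v} → m ≤ n → first f m ≡ suc v → first f n ≡ suc v
first-mono f {m} {n} {v} l e = subst (λ k → first f k ≡ suc v) (m∸n+n≡m l) (go (n ∸ m))
  where
  go : ∀ d → first f (d + m) ≡ suc v
  go zero    = e
  go (suc d) rewrite go d = refl

first-complete : ∀ f {j n} → j < n → f j ≢ 0 → first f n ≢ 0
first-complete f {j} {n} l d with first f (suc j) in eq
... | suc v = λ e → 0≢1+n (trans (sym e) (first-mono f l eq))
... | zero  with first f j
...   | zero  = λ _ → d eq
...   | suc _ = λ _ → 1+n≢0 eq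

first-cong : ∀ {f g} n → (∀ j → j < n → f j ≡ g j) → first f n ≡ first g n
first-cong zero    e = refl
first-cong {f} {g} (suc n) e = cong₂ (λ a b → caseℕ a b suc) (first-cong n (λ j l → e j (m<n⇒m<1+n l))) (e n ≤-refl)

-- Words

infixl 9 _!_
infix 8 _↾_

_!_ : Word → ℕ → ℕ
[]      ! _     = 0
(a ∷ w) ! zero  = suc a
(a ∷ w) ! suc j = w ! j

_↾_ : Baire → ℕ → Word
p ↾ n = applyUpTo p n

↾-! : ∀ p {j n} → j < n → (p ↾ n) ! j ≡ suc (p j)
↾-! p {zero}  (s≤s l) = refl
↾-! p {suc j} (s≤s l) = ↾-! (p ∘ suc) l

↾-!-sound : ∀ p n j {v} → (p ↾ n) ! j ≡ suc v → v ≡ p j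
↾-!-sound p (suc n) zero    refl = refl
↾-!-sound p (suc n) (suc j) e    = ↾-!-sound (p ∘ suc) n j e

↾-cong : ∀ {p q} → p ≗ q → ∀ n → p ↾ n ≡ q ↾ n
↾-cong e zero    = refl
↾-cong e (suc n) = cong₂ _∷_ (e 0) (↾-cong (e ∘ suc) n)

↾-⊏ : ∀ p n → p ↾ n ⊏ p
↾-⊏ p zero    = []
↾-⊏ p (suc n) = refl ∷ ↾-⊏ (p ∘ suc) n

⊏-↾ : ∀ {w p} → w ⊏ p → w ≡ p ↾ length w
⊏-↾ []      = refl
⊏-↾ (e ∷ l) = cong₂ _∷_ e (⊏-↾ l)

take-↾ : ∀ p {m n} → m ≤ n → take m (p ↾ n) ≡ p ↾ m
take-↾ p z≤n     = refl
take-↾ p (s≤s l) = cong (p 0 ∷_) (take-↾ (p ∘ suc) l)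

⊏-! : ∀ {w p} → w ⊏ p → ∀ j {v} → w ! j ≡ suc v → v ≡ p j
⊏-! (e ∷ l) zero    refl = e
⊏-! (e ∷ l) (suc j) d    = ⊏-! l j d

!-⊏ : ∀ {w p} → (∀ j {v} → w ! j ≡ suc v → v ≡ p j) → w ⊏ p
!-⊏ {[]}    d = []
!-⊏ {a ∷ w} d = d 0 refl ∷ !-⊏ (d ∘ suc)

!-< : ∀ w {j} → j < length w → w ! j ≢ 0
!-< (a ∷ w) {zero}  _       ()
!-< (a ∷ w) {suc j} (s≤s l) = !-< w l

lengthᶜ : Γ ⇒ list A → Γ ⇒ nat
lengthᶜ {Γ} {A} W = withRun (foldᶜ (constᶜ 0) (sucᶜ #0) W) {length ∘ run W} (lemma ∘ run W)
  where
  lemma : ∀ (w : List ⟦ A ⟧) → foldr (λ _ n → suc n) 0 w ≡ length w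
  lemma []      = refl
  lemma (a ∷ w) = cong suc (lemma w)

private
  tl : Word → Word
  tl []      = []
  tl (a ∷ w) = w

lookupᶜ : Γ ⇒ list nat → Γ ⇒ nat → Γ ⇒ nat
lookupᶜ {Γ} W J = withRun (foldᶜ (constᶜ 0) (sucᶜ #1) (recᶜ W (tlᶜ #0) J))
  {λ γ → run W γ ! run J γ} (λ γ → trans (cong hd (lemma γ (run J γ))) (drops-! (run W γ) (run J γ)))
  where
  hd : Word → ℕ
  hd = foldr (λ a _ → suc a) 0
  -- As with the predecessor in primitive recursion, the fold builds a list together with its tail.
  tlᶜ : ∀ {Δ} → Δ ⇒ list nat → Δ ⇒ list nat
  tlᶜ {Δ} W = withRun (sndᶜ ∘ᶜ foldᶜ (nilᶜ ,ᶜ nilᶜ) (consᶜ #1 (fstᶜ ∘ᶜ #0) ,ᶜ fstᶜ ∘ᶜ #0) W) {tl ∘ run W} (tl-run ∘ run W)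
    where
    tls : Word → Word × Word
    tls = foldr (λ a z → a ∷ proj₁ z , proj₁ z) ([] , [])
    fst-tls : ∀ w → proj₁ (tls w) ≡ w
    fst-tls []      = refl
    fst-tls (a ∷ w) = cong (a ∷_) (fst-tls w)
    tl-run : ∀ w → proj₂ (tls w) ≡ tl w
    tl-run []      = refl
    tl-run (a ∷ w) = fst-tls w
  drops : Word → ℕ → Word
  drops w zero    = w
  drops w (suc j) = tl (drops w j)
  lemma : ∀ γ j → primrec (run W) (tl ∘ proj₂) (γ , j) ≡ drops (run W γ) j
  lemma γ zero    = refl
  lemma γ (suc j) = cong tl (lemma γ j)
  drops-∷ : ∀ a w j → drops (a ∷ w) (suc j) ≡ drops w j
  drops-∷ a w zero    = refl
  drops-∷ a w (suc j) = cong tl (drops-∷ a w j)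
  drops-[] : ∀ j → drops [] j ≡ []
  drops-[] zero    = refl
  drops-[] (suc j) = cong tl (drops-[] j)
  drops-! : ∀ w j → hd (drops w j) ≡ w ! j
  drops-! []      j       = cong hd (drops-[] j)
  drops-! (a ∷ w) zero    = refl
  drops-! (a ∷ w) (suc j) = trans (cong hd (drops-∷ a w j)) (drops-! w j)

-- Stopping at the first 0 keeps gaps out of the word: what is produced is a genuine prefix, even if
-- some later digits are already known.
gen : (ℕ → ℕ) → ℕ → Word
gen f zero    = []
gen f (suc n) = caseℕ (f 0) [] (λ v → v ∷ gen (f ∘ suc) n)

gen-cong : ∀ {f g} n → f ≗ g → gen f n ≡ gen g n
gen-cong zero    e = refl
gen-cong {f} {g} (suc n) e with f 0 | g 0 | e 0
... | zero  | _ | refl = refl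
... | suc v | _ | refl = cong (v ∷_) (gen-cong n (e ∘ suc))

genᶜ : Γ ⊗ nat ⇒ nat → Γ ⇒ nat → Γ ⇒ list nat
genᶜ {Γ} F N = withRun (letᶜ N (recᶜ nilᶜ step #0))
  {λ γ → gen (λ j → run F (γ , j)) (run N γ)}
  (λ γ → trans (lemma γ (run N γ) (run N γ) ≤-refl)
               (gen-cong (run N γ) (λ j → cong (λ m → run F (γ , m + j)) (n∸n≡0 (run N γ)))))
  where
  -- Stage `i` prepends digit `n ∸ suc i`, so the word grows from its end; an undefined digit resets
  -- it to `[]` and thereby cuts off all that would follow.
  step : ((Γ ⊗ nat) ⊗ nat) ⊗ list nat ⇒ list nat
  step = caseᶜ (F ∘ᶜ (fstᶜ ∘ᶜ fstᶜ ∘ᶜ fstᶜ ,ᶜ #2 ∸ᶜ sucᶜ #1)) nilᶜ (consᶜ #0 #1)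
  lemma : ∀ γ n i → i ≤ n → primrec (λ _ → []) (run step) ((γ , n) , i) ≡ gen (λ j → run F (γ , (n ∸ i) + j)) i
  lemma γ n zero    l = refl
  lemma γ n (suc i) l =
    cong₂ (λ a w → caseℕ a [] (λ v → v ∷ w))
      (cong (λ m → run F (γ , m)) (sym (+-identityʳ _)))
      (trans (lemma γ n i (<⇒≤ l))
        (gen-cong i (λ j → cong (λ m → run F (γ , m))
          (trans (cong (_+ j) (sym (trans (sym (+-∸-assoc 1 l)) refl))) (sym (+-suc (n ∸ suc i) j))))))

gen-⊏ : ∀ {f p} n → (∀ j {v} → f j ≡ suc v → v ≡ p j) → gen f n ⊏ p
gen-⊏ zero d = []
gen-⊏ {f} (suc n) d with f 0 in eq
... | zero  = []
... | suc v = d 0 eq ∷ gen-⊏ n (d ∘ suc)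

gen-length : ∀ {f m} n → m ≤ n → (∀ j → j < m → f j ≢ 0) → m ≤ length (gen f n)
gen-length {m = zero} n l d = z≤n
gen-length {f} {suc m} (suc n) (s≤s l) d with f 0 in eq
... | zero  with () ← d 0 (s≤s z≤n) eq
... | suc v = s≤s (gen-length n l (λ j k → d (suc j) (s≤s k)))

gen-! : ∀ w n → gen (w !_) n ≡ take n w
gen-! w       zero    = refl
gen-! []      (suc n) = refl
gen-! (a ∷ w) (suc n) = cong (a ∷_) (gen-! w n)

takeᶜ : Γ ⇒ nat → Γ ⇒ list nat → Γ ⇒ list nat
takeᶜ N W = withRun (genᶜ (lookupᶜ (W ∘ᶜ fstᶜ) #0) N) {λ γ → take (run N γ) (run W γ)}
  (λ γ → gen-! (run W γ) (run N γ))

-- Coded pairs and words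

pair-unpair : ∀ n → uncurry pair (unpair n) ≡ n
pair-unpair zero    = refl
pair-unpair (suc n) = trans (pair-next (unpair n)) (cong suc (pair-unpair n))
  where
  pair-next : ∀ z → uncurry pair (next z) ≡ suc (uncurry pair z)
  pair-next (zero  , j) = cong (λ m → suc (m + triangle m)) (+-identityʳ j)
  pair-next (suc i , j) = cong (λ m → suc (j + triangle m)) (+-suc i j)

pair-injective : ∀ i j k l → pair i j ≡ pair k l → i ≡ k × j ≡ l
pair-injective i j k l e
  with refl ← trans (sym (unpair-pair i j)) (trans (cong unpair e) (unpair-pair k l)) = refl , refl

digit-injective : ∀ i j k l → 3 + pair i j ≡ 3 + pair k l → i ≡ k × j ≡ l
digit-injective i j k l e = pair-injective i j k l (suc-injective (suc-injective (suc-injective e)))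

n≤triangle : ∀ n → n ≤ triangle n
n≤triangle zero    = z≤n
n≤triangle (suc n) = m≤m+n (suc n) (triangle n)

j≤pair : ∀ i j → j ≤ pair i j
j≤pair i j = m≤m+n j _

i≤pair : ∀ i j → i ≤ pair i j
i≤pair i j = ≤-trans (≤-trans (m≤m+n i j) (n≤triangle (i + j))) (m≤n+m _ j)

codeWord-injective : ∀ u v → codeWord u ≡ codeWord v → u ≡ v
codeWord-injective []      []      _ = refl
codeWord-injective (a ∷ u) (b ∷ v) e =
  let (d , f) = pair-injective a (codeWord u) b (codeWord v) (suc-injective e) in cong₂ _∷_ d (codeWord-injective u v f)

-- Thus every digit from 3 on lists some pair of words, and the analysis of an arbitrary entry of a
-- name may assume that it was written as one.
codeWord-surjective : ∀ n → ∃[ u ] codeWord u ≡ n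
codeWord-surjective n = go n n ≤-refl
  where
  go : ∀ fuel n → n ≤ fuel → ∃[ u ] codeWord u ≡ n
  go _ zero _ = [] , refl
  go (suc fuel) (suc n) (s≤s l) =
    let (a , m) = unpair n
        eq      = pair-unpair n
        (u , e) = go fuel m (≤-trans (≤-trans (j≤pair a m) (≤-reflexive eq)) l)
    in a ∷ u , cong suc (trans (cong (pair a) e) eq)

length≤codeWord : ∀ u → length u ≤ codeWord u
length≤codeWord []      = z≤n
length≤codeWord (a ∷ u) = s≤s (≤-trans (length≤codeWord u) (j≤pair a _))

codeWordᶜ : Γ ⇒ list nat → Γ ⇒ nat
codeWordᶜ W = withRun (foldᶜ (constᶜ 0) (sucᶜ (pairᶜ #1 #0)) W) {codeWord ∘ run W} (lemma ∘ run W)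
  where
  lemma : ∀ w → foldr (λ a c → suc (pair a c)) 0 w ≡ codeWord w
  lemma []      = refl
  lemma (a ∷ w) = cong (suc ∘ pair a) (lemma w)

private
  codeTail : ℕ → ℕ
  codeTail c = proj₂ (unpair (pred c))

  codeDrop : ℕ → ℕ → ℕ
  codeDrop c zero    = c
  codeDrop c (suc j) = codeTail (codeDrop c j)

codeAt : ℕ → ℕ → ℕ
codeAt c j = caseℕ (codeDrop c j) 0 (λ m → suc (proj₁ (unpair m)))

codeAt-codeWord : ∀ w j → codeAt (codeWord w) j ≡ w ! j
codeAt-codeWord w j = go w j
  where
  head : ℕ → ℕ
  head c = caseℕ c 0 (λ m → suc (proj₁ (unpair m)))
  codeDrop-suc : ∀ c j → codeDrop c (suc j) ≡ codeDrop (codeTail c) j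
  codeDrop-suc c zero    = refl
  codeDrop-suc c (suc j) = cong codeTail (codeDrop-suc c j)
  codeDrop-0 : ∀ j → codeDrop 0 j ≡ 0
  codeDrop-0 zero    = refl
  codeDrop-0 (suc j) = cong codeTail (codeDrop-0 j)
  go : ∀ w j → codeAt (codeWord w) j ≡ w ! j
  go []      j       = cong head (codeDrop-0 j)
  go (a ∷ w) zero    = cong (suc ∘ proj₁) (unpair-pair a (codeWord w))
  go (a ∷ w) (suc j) = trans
    (cong head (trans (codeDrop-suc (codeWord (a ∷ w)) j)
                      (cong (λ z → codeDrop (proj₂ z) j) (unpair-pair a (codeWord w)))))
    (go w j)

codeAtᶜ : Γ ⇒ nat → Γ ⇒ nat → Γ ⇒ nat
codeAtᶜ {Γ} C J = withRun (caseᶜ (recᶜ C (codeTailᶜ #0) J) (constᶜ 0) (sucᶜ (fstᶜ ∘ᶜ unpairᶜ #0)))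
  {λ γ → codeAt (run C γ) (run J γ)}
  (λ γ → cong (λ c → caseℕ c 0 (λ m → suc (proj₁ (unpair m)))) (lemma γ (run J γ)))
  where
  codeTailᶜ : ∀ {Δ} → Δ ⇒ nat → Δ ⇒ nat
  codeTailᶜ C = sndᶜ ∘ᶜ unpairᶜ (predᶜ C)
  lemma : ∀ γ j → primrec (run C) (codeTail ∘ proj₂) (γ , j) ≡ codeDrop (run C γ) j
  lemma γ zero    = refl
  lemma γ (suc j) = cong codeTail (lemma γ j)

-- The code itself bounds the length of the word (`length≤codeWord`), so it can serve as the number
-- of digits to try.
decodeᶜ : Γ ⇒ nat → Γ ⇒ list nat
decodeᶜ C = letᶜ C (genᶜ (codeAtᶜ #1 #0) #0)

decode-codeWord : ∀ w → gen (codeAt (codeWord w)) (codeWord w) ≡ w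
decode-codeWord w = trans (gen-cong (codeWord w) (codeAt-codeWord w))
  (trans (gen-! w (codeWord w)) (take-all (codeWord w) w (length≤codeWord w)))

-- Known digits of `f` are coded by successors, so an unknown digit counts as a mismatch too: the
-- value 0 means that the word coded by `c` is already confirmed. The last argument bounds the
-- positions compared; programs pass the code again, which exceeds every position of the word.
mismatch : (ℕ → ℕ) → ℕ → ℕ → ℕ
mismatch f c zero    = 0
mismatch f c (suc n) = caseℕ (codeAt c n) 0 (λ a → distance (suc a) (f n)) + mismatch f c n

mismatchᶜ : Γ ⊗ nat ⇒ nat → Γ ⇒ nat → Γ ⇒ nat → Γ ⇒ nat
mismatchᶜ {Γ} F C N = withRun (recᶜ (constᶜ 0) step N)
  {λ γ → mismatch (λ j → run F (γ , j)) (run C γ) (run N γ)} (λ γ → lemma γ (run N γ))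
  where
  step : (Γ ⊗ nat) ⊗ nat ⇒ nat
  step = caseᶜ (codeAtᶜ (C ∘ᶜ fstᶜ ∘ᶜ fstᶜ) #1) (constᶜ 0)
               (distanceᶜ (sucᶜ #0) (F ∘ᶜ fstᶜ ∘ᶜ fstᶜ)) +ᶜ #0
  lemma : ∀ γ n → primrec (λ _ → 0) (run step) (γ , n) ≡ mismatch (λ j → run F (γ , j)) (run C γ) n
  lemma γ zero    = refl
  lemma γ (suc n) = cong (caseℕ (codeAt (run C γ) n) 0 (λ a → distance (suc a) (run F (γ , n))) +_) (lemma γ n)

mismatch-sound : ∀ {f p u} → mismatch f (codeWord u) (codeWord u) ≡ 0 →
                 (∀ j {a} → f j ≡ suc a → a ≡ p j) → u ⊏ p
mismatch-sound {f} {p} {u} e d = !-⊏ λ j {v} g →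
  d j (sym (distance≡0 (suc v) (f j) (at (codeWord u) j (lt u j g) e (trans (codeAt-codeWord u j) g))))
  where
  lt : ∀ u j {v} → u ! j ≡ suc v → j < codeWord u
  lt (a ∷ u) zero    _ = s≤s z≤n
  lt (a ∷ u) (suc j) g = s≤s (≤-trans (lt u j g) (j≤pair a _))
  at : ∀ n j {v} → j < n → mismatch f (codeWord u) n ≡ 0 →
       codeAt (codeWord u) j ≡ suc v → distance (suc v) (f j) ≡ 0
  at (suc n) j l e g with m≤n⇒m<n∨m≡n (≤-pred l)
  ... | inj₁ k    = at n j k (m+n≡0⇒n≡0 (caseℕ (codeAt (codeWord u) n) 0 _) e) g
  ... | inj₂ refl rewrite g = m+n≡0⇒m≡0 _ e

mismatch-complete : ∀ {f p} u n → u ⊏ p → (∀ j → j < length u → f j ≡ suc (p j)) →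
                    mismatch f (codeWord u) n ≡ 0
mismatch-complete u zero    s d = refl
mismatch-complete {f} {p} u (suc n) s d =
  cong₂ _+_ here (mismatch-complete u n s d)
  where
  !-length : ∀ w j {v} → w ! j ≡ suc v → j < length w
  !-length (a ∷ w) zero    _ = s≤s z≤n
  !-length (a ∷ w) (suc j) e = s≤s (!-length w j e)
  here : caseℕ (codeAt (codeWord u) n) 0 (λ a → distance (suc a) (f n)) ≡ 0
  here rewrite codeAt-codeWord u n with u ! n in eq
  ... | zero  = refl
  ... | suc a rewrite d n (!-length u n eq) | ⊏-! s n eq = distance-refl (p n)

-- Interleaving

halve : ℕ → ℕ × ℕ
halve zero    = 0 , 0
halve (suc n) = caseℕ (proj₂ (halve n)) (proj₁ (halve n) , 1) (λ _ → suc (proj₁ (halve n)) , 0)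

halveᶜ : Γ ⇒ nat → Γ ⇒ nat ⊗ nat
halveᶜ {Γ} N = withRun (recᶜ (constᶜ 0 ,ᶜ constᶜ 0) step N) {λ γ → halve (run N γ)} (λ γ → lemma γ (run N γ))
  where
  step : (Γ ⊗ nat) ⊗ (nat ⊗ nat) ⇒ nat ⊗ nat
  step = caseᶜ (sndᶜ ∘ᶜ #0) (fstᶜ ∘ᶜ #0 ,ᶜ constᶜ 1) (sucᶜ (fstᶜ ∘ᶜ #1) ,ᶜ constᶜ 0)
  lemma : ∀ γ n → primrec (λ _ → 0 , 0) (run step) (γ , n) ≡ halve n
  lemma γ zero    = refl
  lemma γ (suc n) = cong (λ (h , b) → caseℕ b (h , 1) (λ _ → suc h , 0)) (lemma γ n)

halve-even : ∀ n → halve (n + n) ≡ (n , 0)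
halve-odd  : ∀ n → halve (suc (n + n)) ≡ (n , 1)
halve-even zero    = refl
halve-even (suc n) rewrite +-suc n n | halve-odd n = refl
halve-odd n rewrite halve-even n = refl

data Parity : ℕ → Set where
  even : ∀ n → Parity (n + n)
  odd  : ∀ n → Parity (suc (n + n))

parity : ∀ n → Parity n
parity zero = even 0
parity (suc n) with parity n
... | even m = odd m
... | odd m  = subst Parity (cong suc (+-suc m m)) (even (suc m))

weave : (ℕ → ℕ) → (ℕ → ℕ) → ℕ → ℕ
weave f g n = caseℕ (proj₂ (halve n)) (f (proj₁ (halve n))) (λ _ → g (proj₁ (halve n)))

weaveᶜ : Γ ⊗ nat ⇒ nat → Γ ⊗ nat ⇒ nat → Γ ⇒ nat → Γ ⇒ nat
weaveᶜ F G N = letᶜ (halveᶜ N)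
  (caseᶜ (sndᶜ ∘ᶜ #0) (F ∘ᶜ (fstᶜ ,ᶜ fstᶜ ∘ᶜ #0)) (G ∘ᶜ (fstᶜ ∘ᶜ fstᶜ ,ᶜ fstᶜ ∘ᶜ #1)))

weave-even : ∀ f g n → weave f g (n + n) ≡ f n
weave-even f g n rewrite halve-even n = refl

weave-odd : ∀ f g n → weave f g (suc (n + n)) ≡ g n
weave-odd f g n rewrite halve-odd n = refl

-- Partial computable functionals

-- A functional reads a prefix of its oracle; 0 stands for "no result yet" and
-- suc v for the result v.  Neither monotonicity nor consistency is required.
Fn : Type → Set
Fn A = list nat ⊗ A ⇒ nat

Eventually : (ℕ → Set) → Set
Eventually Q = ∃[ t₀ ] ∀ t → t₀ ≤ t → Q t

eventually-map : ∀ {Q R : ℕ → Set} → (∀ {t} → Q t → R t) → Eventually Q → Eventually R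
eventually-map f (t₀ , q) = t₀ , λ t l → f (q t l)

eventually-× : ∀ {Q R : ℕ → Set} → Eventually Q → Eventually R → Eventually (λ t → Q t × R t)
eventually-× (t₀ , q) (t₁ , r) =
  t₀ ⊔ t₁ , λ t l → q t (m⊔n≤o⇒m≤o t₀ t₁ l) , r t (m⊔n≤o⇒n≤o t₀ t₁ l)

∀<-suc : ∀ {Q : ℕ → Set} {n} → (∀ j → j < n → Q j) → Q n → ∀ j → j < suc n → Q j
∀<-suc f z j l with m≤n⇒m<n∨m≡n (≤-pred l)
... | inj₁ k    = f j k
... | inj₂ refl = z

eventually-∀< : ∀ {Q : ℕ → ℕ → Set} n → (∀ j → Eventually (Q j)) → Eventually (λ t → ∀ j → j < n → Q j t)
eventually-∀< zero    q = 0 , λ _ _ _ ()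
eventually-∀< {Q} (suc n) q = eventually-map (λ {t} (f , z) → ∀<-suc {λ j → Q j t} f z)
  (eventually-× (eventually-∀< {Q} n q) (q n))

-- Separated from definedness because a search must also control the candidates that never give a
-- result: these may stay undefined, but must not give a wrong one.
Sound : Fn A → Baire → ⟦ A ⟧ → ℕ → Set
Sound P p a v = ∀ t {v′} → run P (p ↾ t , a) ≡ suc v′ → v′ ≡ v

record Yields (P : Fn A) (p : Baire) (a : ⟦ A ⟧) (v : ℕ) : Set where
  constructor yields
  field
    defined : Eventually (λ t → run P (p ↾ t , a) ≢ 0)
    sound   : Sound P p a v

open Yields

exact : ∀ {P : Fn A} {p a v} → Yields P p a v → Eventually (λ t → run P (p ↾ t , a) ≡ suc v)
exact {P = P} {p} {a} (yields (t₀ , d) s) = t₀ , λ t l → at t (d t l)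
  where
  at : ∀ t → run P (p ↾ t , a) ≢ 0 → run P (p ↾ t , a) ≡ suc _
  at t n with run P (p ↾ t , a) in eq
  ... | zero  with () ← n refl
  ... | suc v = cong suc (s t eq)

exactly : ∀ {P : Fn A} {p a v} → Eventually (λ t → run P (p ↾ t , a) ≡ suc v) → Sound P p a v → Yields P p a v
exactly e s = yields (eventually-map (λ d c → 0≢1+n (trans (sym c) d)) e) s

Yields-≡ : ∀ {P : Fn A} {p a v v′} → v ≡ v′ → Yields P p a v → Yields P p a v′
Yields-≡ refl y = y

Yields-cong : ∀ {P : Fn A} {p p′ a v} → p ≗ p′ → Yields P p a v → Yields P p′ a v
Yields-cong {P = P} {a = a} e (yields (t₀ , d) s) = yields
  (t₀ , λ t l → subst (λ w → run P (w , a) ≢ 0) (↾-cong e t) (d t l))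
  (λ t c → s t (trans (cong (λ w → run P (w , a)) (↾-cong e t)) c))

pureᶠ : A ⇒ nat → Fn A
pureᶠ g = sucᶜ (g ∘ᶜ sndᶜ)

Yields-pure : ∀ {g : A ⇒ nat} {p a} → Yields (pureᶠ g) p a (run g a)
Yields-pure = yields (0 , λ _ _ ()) (λ _ e → suc-injective (sym e))

askᶠ : A ⇒ nat → Fn A
askᶠ g = lookupᶜ fstᶜ (g ∘ᶜ sndᶜ)

Yields-ask : ∀ {g : A ⇒ nat} {p a} → Yields (askᶠ g) p a (p (run g a))
Yields-ask {g = g} {p} {a} = exactly (suc (run g a) , λ t l → ↾-! p l) (λ t → ↾-!-sound p t (run g a))

bindᶠ : Fn A → Fn (A ⊗ nat) → Fn A
bindᶠ P Q = caseᶜ P (constᶜ 0) (Q ∘ᶜ (fstᶜ ∘ᶜ fstᶜ ,ᶜ (#1 ,ᶜ #0)))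

Yields-bind : ∀ {P : Fn A} {Q : Fn (A ⊗ nat)} {p a v u} →
              Yields P p a v → Yields Q p (a , v) u → Yields (bindᶠ P Q) p a u
Yields-bind {P = P} {Q} {p} {a} {v} {u} y z = yields
  (eventually-map (λ (e , n) → subst (λ m → caseℕ m 0 (λ v → run Q (_ , a , v)) ≢ 0) (sym e) n)
    (eventually-× (exact y) (defined z)))
  s
  where
  s : Sound (bindᶠ P Q) p a u
  s t e with run P (p ↾ t , a) in eq
  ... | suc v′ with refl ← sound y t eq = sound z t e

caseᶠ : A ⇒ nat → Fn A → Fn (A ⊗ nat) → Fn A
caseᶠ g P Q = caseᶜ (g ∘ᶜ sndᶜ) P (Q ∘ᶜ (fstᶜ ∘ᶜ fstᶜ ,ᶜ (#1 ,ᶜ #0)))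

Yields-zero : ∀ {g : A ⇒ nat} {P : Fn A} {Q : Fn (A ⊗ nat)} {p a v} →
              run g a ≡ 0 → Yields P p a v → Yields (caseᶠ g P Q) p a v
Yields-zero {P = P} {Q} {p} {a} e y =
  yields (subst (λ m → Eventually (λ t → caseℕ m (run P (p ↾ t , a)) (λ n → run Q (p ↾ t , a , n)) ≢ 0))
            (sym e) (defined y))
         (subst (λ m → ∀ t {v′} → caseℕ m (run P (p ↾ t , a)) (λ n → run Q (p ↾ t , a , n)) ≡ suc v′ → v′ ≡ _)
            (sym e) (sound y))

Yields-suc : ∀ {g : A ⇒ nat} {P : Fn A} {Q : Fn (A ⊗ nat)} {p a n v} →
             run g a ≡ suc n → Yields Q p (a , n) v → Yields (caseᶠ g P Q) p a v
Yields-suc {P = P} {Q} {p} {a} e y =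
  yields (subst (λ m → Eventually (λ t → caseℕ m (run P (p ↾ t , a)) (λ n → run Q (p ↾ t , a , n)) ≢ 0))
            (sym e) (defined y))
         (subst (λ m → ∀ t {v′} → caseℕ m (run P (p ↾ t , a)) (λ n → run Q (p ↾ t , a , n)) ≡ suc v′ → v′ ≡ _)
            (sym e) (sound y))

infixr 9 _∘ᶠ_

_∘ᶠ_ : Fn B → A ⇒ B → Fn A
P ∘ᶠ g = P ∘ᶜ (fstᶜ ,ᶜ g ∘ᶜ sndᶜ)

Yields-∘ : ∀ {P : Fn B} {g : A ⇒ B} {p a v} → Yields P p (run g a) v → Yields (P ∘ᶠ g) p a v
Yields-∘ (yields d s) = yields d s

searchᶠ : Fn (A ⊗ nat) → Fn A
searchᶠ R = firstᶜ (R ∘ᶜ (fstᶜ ∘ᶜ fstᶜ ,ᶜ (#1 ,ᶜ #0))) (lengthᶜ fstᶜ)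

-- The length of the oracle prefix bounds the search, so stage `t` tries all candidates below `t`
-- with `t` digits each. One of them has to succeed; as the one found first may depend on the stage,
-- all must be sound for the same value.
Yields-search : ∀ {R : Fn (A ⊗ nat)} {p a v} n → Eventually (λ t → run R (p ↾ t , a , n) ≢ 0) →
                (∀ n → Sound R p (a , n) v) → Yields (searchᶠ R) p a v
Yields-search {R = R} {p} {a} n (t₀ , d) s = yields
  (t₀ ⊔ suc n , λ t l → first-complete (λ j → run R (p ↾ t , a , j))
    (subst (n <_) (sym (length-applyUpTo p t)) (m⊔n≤o⇒n≤o t₀ (suc n) l))
    (d t (m⊔n≤o⇒m≤o t₀ (suc n) l)))
  (λ t e → let (j , _ , e′) = first-sound (λ j → run R (p ↾ t , a , j)) (length (p ↾ t)) e in s j t e′)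

composeᶠ : Fn B → Fn (A ⊗ nat) → Fn (A ⊗ B)
composeᶠ P Q = P ∘ᶜ (genᶜ (Q ∘ᶜ (fstᶜ ∘ᶜ fstᶜ ,ᶜ (fstᶜ ∘ᶜ #1 ,ᶜ #0))) (lengthᶜ fstᶜ) ,ᶜ sndᶜ ∘ᶜ sndᶜ)

-- At every stage `P` receives a prefix of `q`, by soundness of `Q`. Its length need not grow
-- steadily, but it eventually exceeds every bound, and `Yields` asks for no more.
Yields-compose : ∀ {P : Fn B} {Q : Fn (A ⊗ nat)} {p q a b v} →
                 (∀ j → Yields Q p (a , j) (q j)) → Yields P q b v → Yields (composeᶠ P Q) p (a , b) v
Yields-compose {P = P} {Q} {p} {q} {a} {b} {v} y (yields (t₀ , d) s) = yields
  (eventually-map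
    (λ {t} (f , l) → subst (λ w → run P (w , b) ≢ 0) (sym (prefix t))
       (d _ (gen-length (length (p ↾ t)) (subst (t₀ ≤_) (sym (length-applyUpTo p t)) l) f)))
    (eventually-× (eventually-∀< t₀ (defined ∘ y)) (t₀ , λ _ l → l)))
  (λ t e → s _ (trans (cong (λ w → run P (w , b)) (sym (prefix t))) e))
  where
  word : ℕ → Word
  word t = gen (λ j → run Q (p ↾ t , a , j)) (length (p ↾ t))
  prefix : ∀ t → word t ≡ q ↾ length (word t)
  prefix t = ⊏-↾ (gen-⊏ (length (p ↾ t)) (λ j e → sound (y j) t e))

Computes : Fn nat → Baire → Baire → Set
Computes P p r = ∀ k → Yields P p k (r k)

weaveᶠ : Fn nat → Fn nat → Fn nat
weaveᶠ P Q = weaveᶜ (P ∘ᶜ (fstᶜ ∘ᶜ fstᶜ ,ᶜ #0)) (Q ∘ᶜ (fstᶜ ∘ᶜ fstᶜ ,ᶜ #0)) sndᶜ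

Computes-weave : ∀ {P Q : Fn nat} {p q r} → Computes P p q → Computes Q p r → Computes (weaveᶠ P Q) p ⟨ q , r ⟩
Computes-weave {P} {Q} {p} {q} {r} y z k with parity k
... | even n = Yields-≡ {P = weaveᶠ P Q} (sym (evens-⟨,⟩ q r n)) (yields
  (eventually-map (λ {t} → subst (_≢ 0) (sym (weave-even (F t) (G t) n))) (defined (y n)))
  (λ t e → sound (y n) t (trans (sym (weave-even (F t) (G t) n)) e)))
  where
  F = λ t j → run P (p ↾ t , j)
  G = λ t j → run Q (p ↾ t , j)
... | odd n = Yields-≡ {P = weaveᶠ P Q} (sym (odds-⟨,⟩ q r n)) (yields
  (eventually-map (λ {t} → subst (_≢ 0) (sym (weave-odd (F t) (G t) n))) (defined (z n)))
  (λ t e → sound (z n) t (trans (sym (weave-odd (F t) (G t) n)) e)))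
  where
  F = λ t j → run P (p ↾ t , j)
  G = λ t j → run Q (p ↾ t , j)

-- The k-th digit, if any, of the output which the entry d of a name yields on input x;
-- both x and the result are coded as suc n or 0.
tryDigit : (ℕ → ℕ) → ℕ → ℕ → ℕ
tryDigit x d k = caseℕ (d ∸ 2) 0 (λ m →
  caseℕ (mismatch x (proj₁ (unpair m)) (proj₁ (unpair m))) (codeAt (proj₂ (unpair m)) k) (λ _ → 0))

tryDigitᶜ : Γ ⊗ nat ⇒ nat → Γ ⇒ nat → Γ ⇒ nat → Γ ⇒ nat
-- Subtracting 2 rather than 3 sends the dummy digits 0, 1, 2 to the failing branch and `3 + m` to
-- the branch with `m`.
tryDigitᶜ X E K = caseᶜ (E ∸ᶜ constᶜ 2) (constᶜ 0) (letᶜ (unpairᶜ #0)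
  (caseᶜ (mismatchᶜ (X ∘ᶜ (fstᶜ ∘ᶜ fstᶜ ∘ᶜ fstᶜ ,ᶜ #0)) (fstᶜ ∘ᶜ #0) (fstᶜ ∘ᶜ #0))
    (codeAtᶜ (sndᶜ ∘ᶜ #0) (K ∘ᶜ fstᶜ ∘ᶜ fstᶜ)) (constᶜ 0)))

applyStepᶠ : Fn (A ⊗ nat) → Fn (A ⊗ nat) → Fn ((A ⊗ nat) ⊗ nat)
applyStepᶠ Q X = bindᶠ (Q ∘ᶠ (fstᶜ ∘ᶜ fstᶜ ,ᶜ #0))
  (tryDigitᶜ (X ∘ᶜ (fstᶜ ∘ᶜ fstᶜ ,ᶜ (fstᶜ ∘ᶜ fstᶜ ∘ᶜ fstᶜ ∘ᶜ #1 ,ᶜ #0))) (#0 ∘ᶜ sndᶜ) (#2 ∘ᶜ sndᶜ))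

applyStep-run : ∀ (Q X : Fn (A ⊗ nat)) w a k i → run (applyStepᶠ Q X) (w , ((a , k) , i)) ≡
  caseℕ (run Q (w , (a , i))) 0 (λ d → tryDigit (λ j → run X (w , (a , j))) d k)
applyStep-run Q X w a k i = refl

applyᶠ : Fn (A ⊗ nat) → Fn (A ⊗ nat) → Fn (A ⊗ nat)
applyᶠ Q X = searchᶠ (applyStepᶠ Q X)

tryDigit-sound : ∀ {q p r x} i k {v} → Φ q p r → (∀ j {a} → x j ≡ suc a → a ≡ p j) →
                 tryDigit x (q i) k ≡ suc v → v ≡ r k
tryDigit-sound {q} {p} {r} {x} i k {v} φ s e with q i in eqᵢ
... | suc (suc (suc m)) with unpair m in eqₘ
...   | (cu , cv) with codeWord-surjective cu | codeWord-surjective cv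
...     | (u , refl) | (w , refl) with mismatch x (codeWord u) (codeWord u) in eq
...       | zero = ⊏-! (proj₁ φ w (u , mismatch-sound eq s , i ,
                        trans eqᵢ (cong (3 +_) (trans (sym (pair-unpair m)) (cong (uncurry pair) eqₘ)))))
                      k (trans (sym (codeAt-codeWord w k)) e)

tryDigit-complete : ∀ {p x u v} d k → d ≡ 3 + pair (codeWord u) (codeWord v) → u ⊏ p →
                    (∀ j → j < length u → x j ≡ suc (p j)) → k < length v → tryDigit x d k ≢ 0
tryDigit-complete {u = u} {v} d k refl s c l
  rewrite unpair-pair (codeWord u) (codeWord v) | mismatch-complete u (codeWord u) s c
        | codeAt-codeWord v k = !-< v l

-- The search runs over the entries of the name. The length clause in `Φ q x r` supplies an entry
-- that delivers digit `k`; any other entry that succeeds lists a prefix of `r` and hence delivers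
-- the same digit.
Yields-apply : ∀ {Q X : Fn (A ⊗ nat)} {p q x r a} → (∀ j → Yields Q p (a , j) (q j)) →
               (∀ j → Yields X p (a , j) (x j)) → Φ q x r → ∀ k → Yields (applyᶠ Q X) p (a , k) (r k)
Yields-apply {Q = Q} {X} {p} {q} {x} {r} {a} y z φ k = Yields-search {R = applyStepᶠ Q X} i hit noMiss
  where
  F : ℕ → ℕ → ℕ
  F t j = run X (p ↾ t , (a , j))
  v = proj₁ (proj₂ φ k)
  u = proj₁ (proj₁ (proj₂ (proj₂ φ k)))
  s = proj₁ (proj₂ (proj₁ (proj₂ (proj₂ φ k))))
  i = proj₁ (proj₂ (proj₂ (proj₁ (proj₂ (proj₂ φ k)))))
  e = proj₂ (proj₂ (proj₂ (proj₁ (proj₂ (proj₂ φ k)))))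
  l = proj₂ (proj₂ (proj₂ φ k))
  hit : Eventually (λ t → run (applyStepᶠ Q X) (p ↾ t , ((a , k) , i)) ≢ 0)
  hit = eventually-map
    (λ {t} (f , g) c → tryDigit-complete (q i) k e s g l
      (trans (cong (λ m → caseℕ m 0 (λ d → tryDigit (F t) d k)) (sym f))
             (trans (sym (applyStep-run Q X (p ↾ t) a k i)) c)))
    (eventually-× (exact {P = Q} (y i)) (eventually-∀< (length u) (λ j → exact {P = X} (z j))))
  noMiss : ∀ n → Sound (applyStepᶠ Q X) p ((a , k) , n) (r k)
  noMiss n t c = go (trans (sym (applyStep-run Q X (p ↾ t) a k n)) c)
    where
    go : ∀ {v′} → caseℕ (run Q (p ↾ t , (a , n))) 0 (λ d → tryDigit (F t) d k) ≡ suc v′ → v′ ≡ r k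
    go e with run Q (p ↾ t , (a , n)) in eq
    ... | suc d with refl ← sound (y n) t eq = tryDigit-sound n k φ (λ j → sound (z j) t) e

graphOf : Fn nat → PartialFunction
graphOf P .graph              = Computes P
graphOf P .graph-cong d e y k = Yields-≡ {P = P} (e k) (Yields-cong d (y k))
graphOf P .graph-unique y z k =
  let (t₀ , d) = exact (y k) in sound (z k) t₀ (d t₀ ≤-refl)

-- Taking the result at the first prefix which gives one makes a functional monotone.
wordFunction : Fn nat → list nat ⇒ list nat
wordFunction P = genᶜ (firstᶜ (P ∘ᶜ (takeᶜ #0 (fstᶜ ∘ᶜ fstᶜ) ,ᶜ #1)) (sucᶜ (lengthᶜ fstᶜ))) (lengthᶜ idᶜ)

⊑-length : ∀ {v w} → v ⊑ w → length v ≤ length w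
⊑-length []      = z≤n
⊑-length (_ ∷ l) = s≤s (⊑-length l)

private
  ⊑-take : ∀ {v w n} → v ⊑ w → n ≤ length v → take n v ≡ take n w
  ⊑-take {n = zero} l k = refl
  ⊑-take {n = suc n} (refl ∷ l) (s≤s k) = cong (_ ∷_) (⊑-take l k)

  gen-⊑ : ∀ {f g m n} → m ≤ n → (∀ j {v} → f j ≡ suc v → g j ≡ suc v) → gen f m ⊑ gen g n
  gen-⊑ z≤n d = []
  gen-⊑ {f} {g} (s≤s l) d with f 0 in eq
  ... | zero  = []
  ... | suc v rewrite d 0 eq = refl ∷ gen-⊑ l (d ∘ suc)

module _ (P : Fn nat) where

  private
    try : Word → ℕ → ℕ → ℕ
    try w k n = run P (take n w , k)

  -- The longer word has the same short prefixes, and these are tried first and in the same order.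
  wordFunction-monotone : ∀ {v w} → v ⊑ w → run (wordFunction P) v ⊑ run (wordFunction P) w
  wordFunction-monotone {v} {w} l = gen-⊑ (⊑-length l) λ k e →
    first-mono (try w k) (s≤s (⊑-length l))
      (trans (sym (first-cong {try v k} {try w k} (suc (length v))
        (λ j j< → cong (λ u → run P (u , k)) (⊑-take l (≤-pred j<))))) e)

  graphOf-computable : IsComputable (graphOf P)
  graphOf-computable = run (wordFunction P) , computable (wordFunction P) , wordFunction-monotone ,
    λ p r y → (λ { _ (w , s , refl) → upper p r y w s }) , long p r y
    where
    upper : ∀ p r → Computes P p r → ∀ w → w ⊏ p → run (wordFunction P) w ⊏ r
    upper p r y w s = subst (λ w → run (wordFunction P) w ⊏ r) (sym (⊏-↾ s))
      (gen-⊏ (length (p ↾ n)) λ k e → let (j , l , d) = first-sound (try (p ↾ n) k) (suc (length (p ↾ n))) e in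
        sound (y k) j (trans (cong (λ u → run P (u , k))
          (sym (take-↾ p (subst (j ≤_) (length-applyUpTo p n) (≤-pred l))))) d))
      where n = length w
    long : ∀ p r → Computes P p r → ∀ n → ∃[ v ] (∃[ w ] w ⊏ p × v ≡ run (wordFunction P) w) × n < length v
    long p r y n with eventually-× (eventually-∀< (suc n) (defined ∘ y)) (suc n , λ _ l → l)
    ... | (t , d) with d t ≤-refl
    ...   | (f , l) = _ , (p ↾ t , ↾-⊏ p t , refl) ,
      gen-length (length (p ↾ t)) (subst (suc n ≤_) (sym (length-applyUpTo p t)) l)
        (λ k k< → first-complete (try (p ↾ t) k)
          (subst (λ m → t < suc m) (sym (length-applyUpTo p t)) ≤-refl)
          (λ e → f k k< (trans (cong (λ u → run P (u , k)) (sym (take-↾ p ≤-refl))) e)))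

⊏-⊑ : ∀ {v w p} → v ⊏ p → w ⊏ p → length v ≤ length w → v ⊑ w
⊏-⊑ []      _       _       = []
⊏-⊑ (e ∷ l) (f ∷ m) (s≤s k) = trans e (sym f) ∷ ⊏-⊑ l m k

-- For long outputs, some prefix `u` of the intermediate point makes `γ u` long; some `φ w` extends
-- `u`, and monotonicity of `γ` transfers the length.
∘ᵖ-computable : ∀ {G F} → IsComputable G → IsComputable F → IsComputable (G ∘ᵖ F)
∘ᵖ-computable {G} {F} (γ , γc , γm , γs) (φ , φc , φm , φs) =
  γ ∘ φ , comp γc φc , γm ∘ φm , λ { p r (q , f , g) →
    (λ { v (w , s , refl) → proj₁ (γs q r g) _ (φ w , proj₁ (φs p q f) _ (w , s , refl) , refl) }) ,
    λ n → long p q r f g n }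
  where
  long : ∀ p q r → graph F p q → graph G q r → ∀ n → ∃[ v ] (∃[ w ] w ⊏ p × v ≡ γ (φ w)) × n < length v
  long p q r f g n with proj₂ (γs q r g) n
  ... | (_ , (u , s , refl) , l) with proj₂ (φs p q f) (length u)
  ...   | (_ , (w , t , refl) , m) = _ , (w , t , refl) ,
    ≤-trans l (⊑-length (γm (⊏-⊑ s (proj₁ (φs p q f) _ (w , t , refl)) (<⇒≤ m))))

≤sW-trans : ∀ {X₁ Y₁ X₂ Y₂ X₃ Y₃} {f : X₁ ⇉ Y₁} {g : X₂ ⇉ Y₂} {h : X₃ ⇉ Y₃} →
            f ≤sW g → g ≤sW h → f ≤sW h
≤sW-trans (H₁ , K₁ , H₁c , K₁c , red₁) (H₂ , K₂ , H₂c , K₂c , red₂) =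
  H₁ ∘ᵖ H₂ , K₂ ∘ᵖ K₁ , ∘ᵖ-computable {H₁} {H₂} H₁c H₂c , ∘ᵖ-computable {K₂} {K₁} K₂c K₁c ,
  λ G G⊢h p x δ d →
    let (r , (b , (a , k₁ , c , (d , k₂ , y) , h₂) , h₁) , z) =
          red₁ (H₂ ∘ᵖ G ∘ᵖ K₂) (red₂ G G⊢h) p x δ d
    in r , (c , (d , (a , k₁ , k₂) , y) , b , h₂ , h₁) , z

-- Names

graphName : list nat ⇒ list nat → nat ⇒ nat
graphName φ = sucᶜ (sucᶜ (sucᶜ (pairᶜ idᶜ (codeWordᶜ (φ ∘ᶜ decodeᶜ idᶜ)))))

graphName-Φ : ∀ {φ p r} → IsSup (λ v → ∃[ w ] w ⊏ p × v ≡ run φ w) r → Φ (run (graphName φ)) p r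
graphName-Φ {φ} {p} = IsSup-cong to from (λ _ → refl)
  where
  to : ∀ v → (∃[ w ] w ⊏ p × v ≡ run φ w) → ∃[ u ] u ⊏ p × run (graphName φ) Lists u ↦ v
  to _ (w , s , refl) = w , s , codeWord w ,
    cong (λ u → 3 + pair (codeWord w) (codeWord (run φ u))) (decode-codeWord w)
  from : ∀ v → (∃[ u ] u ⊏ p × run (graphName φ) Lists u ↦ v) → ∃[ w ] w ⊏ p × v ≡ run φ w
  from v (u , s , i , e) with digit-injective i _ (codeWord u) (codeWord v) e
  ... | (refl , d) = u , s ,
    codeWord-injective v (run φ u) (trans (sym d) (cong (codeWord ∘ run φ) (decode-codeWord u)))

computableName : ∀ {F} → IsComputable F → Σ (nat ⇒ nat) λ e → ∀ {p r} → graph F p r → Φ (run e) p r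
computableName (φ , φc , _ , sup) = let P = record { run = φ ; computable = φc } in
  graphName P , λ {p} {r} f → graphName-Φ {P} {p} {r} (sup p r f)

-- Lists [ a ] ↦ [], which is without effect on Φ.
dummy : ℕ → ℕ
dummy a = 3 + pair (suc (pair a 0)) 0

undummy : ℕ → ℕ
undummy d = proj₁ (unpair (pred (proj₁ (unpair (d ∸ 3)))))

undummy-dummy : ∀ a → undummy (dummy a) ≡ a
undummy-dummy a rewrite unpair-pair (suc (pair a 0)) 0 | unpair-pair a 0 = refl

undummyᶜ : Γ ⇒ nat → Γ ⇒ nat
undummyᶜ E = fstᶜ ∘ᶜ unpairᶜ (predᶜ (fstᶜ ∘ᶜ unpairᶜ (E ∸ᶜ constᶜ 3)))

-- If the program stored in w lists a pair (c₀ , cv) such that c₀ codes a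
-- prefix of the pair of w and the word coded by c, then list (c , cv).
curryDigit : Word → ℕ → ℕ → ℕ
curryDigit w c i = caseℕ (w ! pair 1 i) 0 (λ d → caseℕ (d ∸ 2) 0 (λ m →
  caseℕ (mismatch (weave (w !_) (codeAt c)) (proj₁ (unpair m)) (proj₁ (unpair m)))
        (3 + pair c (proj₂ (unpair m))) (λ _ → 0)))

-- Tag 0 marks the state digits in dummy form. All positive tags repeat the same curried entries, so
-- that each is tried again at later positions, where longer prefixes of the state are at hand.
payloadDigit : Word → ℕ × ℕ → ℕ
payloadDigit w (b , c) = caseℕ b
  (caseℕ (w ! c) 0 dummy)
  (λ _ → curryDigit w (proj₁ (unpair c)) (proj₂ (unpair c)))

-- Both 0 and 1 are dummy symbols, so position 0 is free to carry the halting flag that the loop of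
-- `F ^◇` inspects.
nameDigit : Word → ℕ → ℕ
nameDigit w k = caseℕ k (caseℕ (w ! 0) 0 (λ a → caseℕ a 0 (λ _ → 1))) (λ k → payloadDigit w (unpair k))

nameDigitᶜ : Γ ⇒ list nat → Γ ⇒ nat → Γ ⇒ nat
nameDigitᶜ W K = letᶜ (W ,ᶜ K) (caseᶜ (sndᶜ ∘ᶜ #0)
  (caseᶜ (lookupᶜ (fstᶜ ∘ᶜ #0) (constᶜ 0)) (constᶜ 0) (caseᶜ #0 (constᶜ 0) (constᶜ 1)))
  (letᶜ (fstᶜ ∘ᶜ #1 ,ᶜ unpairᶜ #0) (payloadᶜ ∘ᶜ #0)))
  where
  dummyᶜ : ∀ {Δ} → Δ ⇒ nat → Δ ⇒ nat
  dummyᶜ P = sucᶜ (sucᶜ (sucᶜ (pairᶜ (sucᶜ (pairᶜ P (constᶜ 0))) (constᶜ 0))))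
  curryᶜ : list nat ⊗ (nat ⊗ nat) ⇒ nat
  curryᶜ = caseᶜ (lookupᶜ fstᶜ (pairᶜ (constᶜ 1) (sndᶜ ∘ᶜ sndᶜ))) (constᶜ 0)
    (caseᶜ (#0 ∸ᶜ constᶜ 2) (constᶜ 0)
      (letᶜ (unpairᶜ #0)
        (caseᶜ (mismatchᶜ (weaveᶜ (lookupᶜ (fstᶜ ∘ᶜ base ∘ᶜ fstᶜ ∘ᶜ fstᶜ) #0)
                                   (codeAtᶜ (fstᶜ ∘ᶜ sndᶜ ∘ᶜ base ∘ᶜ fstᶜ ∘ᶜ fstᶜ) #0) #0)
                 (fstᶜ ∘ᶜ #0) (fstᶜ ∘ᶜ #0))
          (sucᶜ (sucᶜ (sucᶜ (pairᶜ (fstᶜ ∘ᶜ sndᶜ ∘ᶜ base) (sndᶜ ∘ᶜ #0)))))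
          (constᶜ 0))))
    where
    base : ∀ {A B C D} → ((A ⊗ B) ⊗ C) ⊗ D ⇒ A
    base = fstᶜ ∘ᶜ fstᶜ ∘ᶜ fstᶜ
  payloadᶜ : list nat ⊗ (nat ⊗ nat) ⇒ nat
  payloadᶜ = caseᶜ (fstᶜ ∘ᶜ sndᶜ)
    (caseᶜ (lookupᶜ fstᶜ (sndᶜ ∘ᶜ sndᶜ)) (constᶜ 0) (dummyᶜ #0))
    (curryᶜ ∘ᶜ (fstᶜ ∘ᶜ fstᶜ ,ᶜ unpairᶜ (sndᶜ ∘ᶜ sndᶜ ∘ᶜ fstᶜ)))

-- The name of the function x ↦ Φ e ⟨ s , x ⟩, where e = component 1 s.  Its
-- dummy digits give away s, and its first digit is 0 if and only if s 0 is.
nameOf : Baire → Baire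
nameOf s k = nameDigit (s ↾ suc k) k

payloadAt : ℕ → ℕ
payloadAt j = suc (pair 0 j)

nameOf-payload : ∀ s j → undummy (nameOf s (payloadAt j)) ≡ s j
nameOf-payload s j
  rewrite unpair-pair 0 j | ↾-! s {j} {suc (payloadAt j)} (m<n⇒m<1+n (s≤s (j≤pair 0 j))) = undummy-dummy (s j)

curryDigit-sound : ∀ {s x r} n u i v → Φ (component 1 s) ⟨ s , x ⟩ r → u ⊏ x →
                   curryDigit (s ↾ n) (codeWord u) i ≡ 3 + pair (codeWord u) (codeWord v) → v ⊏ r
curryDigit-sound {s} {x} n u i v φ l e with (s ↾ n) ! pair 1 i in eqᵢ
... | suc (suc (suc (suc m))) with unpair m in eqₘ
...   | (c₀ , cv) with codeWord-surjective c₀ | codeWord-surjective cv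
...     | (u₀ , refl) | (w , refl) with mismatch (weave ((s ↾ n) !_) (codeAt (codeWord u))) (codeWord u₀) (codeWord u₀) in eq
...       | zero with refl ← codeWord-injective w v
                         (proj₂ (digit-injective (codeWord u) (codeWord w) (codeWord u) (codeWord v) e)) =
  proj₁ φ w (u₀ , mismatch-sound eq matches , i ,
    trans (sym (↾-!-sound s n (pair 1 i) eqᵢ)) (cong (3 +_) (trans (sym (pair-unpair m)) (cong (uncurry pair) eqₘ))))
  where
  matches : ∀ j {a} → weave ((s ↾ n) !_) (codeAt (codeWord u)) j ≡ suc a → a ≡ ⟨ s , x ⟩ j
  matches j e with parity j
  ... | even m = trans
    (↾-!-sound s n m (trans (sym (weave-even ((s ↾ n) !_) (codeAt (codeWord u)) m)) e))
    (sym (evens-⟨,⟩ s x m))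
  ... | odd m  = trans
    (⊏-! l m (trans (sym (trans (weave-odd ((s ↾ n) !_) (codeAt (codeWord u)) m) (codeAt-codeWord u m))) e))
    (sym (odds-⟨,⟩ s x m))

weave-prefixes : ∀ {s x} n m j → m ≤ n → j < m →
                 weave ((s ↾ n) !_) (codeAt (codeWord (x ↾ m))) j ≡ suc (⟨ s , x ⟩ j)
weave-prefixes {s} {x} n m j l h with parity j
... | even a = trans (weave-even ((s ↾ n) !_) (codeAt (codeWord (x ↾ m))) a)
  (trans (↾-! s (<-≤-trans (≤-<-trans (m≤m+n a a) h) l)) (cong suc (sym (evens-⟨,⟩ s x a))))
... | odd a = trans (weave-odd ((s ↾ n) !_) (codeAt (codeWord (x ↾ m))) a)
  (trans (codeAt-codeWord (x ↾ m) a)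
    (trans (↾-! x (≤-<-trans (≤-trans (m≤m+n a a) (n≤1+n (a + a))) h)) (cong suc (sym (odds-⟨,⟩ s x a)))))

-- A prefix of `⟨ s , x ⟩` draws on even shorter prefixes of `s` and `x`, so as many digits of `x`
-- as `u₀` has suffice to confirm `u₀`. The two bounds on `n` make the program entry and enough of
-- `s` available.
curryDigit-complete : ∀ {s x} n u₀ v i → u₀ ⊏ ⟨ s , x ⟩ → component 1 s i ≡ 3 + pair (codeWord u₀) (codeWord v) →
                      pair 1 i < n → length u₀ ≤ n →
                      let c = codeWord (x ↾ length u₀) in curryDigit (s ↾ n) c i ≡ 3 + pair c (codeWord v)
curryDigit-complete {s} {x} n u₀ v i l e k m
  rewrite ↾-! s k | e | unpair-pair (codeWord u₀) (codeWord v)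
        | mismatch-complete {weave ((s ↾ n) !_) (codeAt (codeWord (x ↾ length u₀)))} u₀ (codeWord u₀) l
            (λ j → weave-prefixes n (length u₀) j m) = refl

nameOf-Φ : ∀ {s x r} → Φ (component 1 s) ⟨ s , x ⟩ r → Φ (nameOf s) x r
nameOf-Φ {s} {x} {r} φ = upper , long
  where
  upper : ∀ v → (∃[ u ] u ⊏ x × nameOf s Lists u ↦ v) → v ⊏ r
  upper v (u , l , zero , e) = impossible (s 0) e
    where
    impossible : ∀ a → caseℕ a 0 (λ _ → 1) ≡ 3 + pair (codeWord u) (codeWord v) → v ⊏ r
    impossible zero    ()
    impossible (suc a) ()
  upper v (u , l , suc k , e) = payload (unpair k) e
    where
    w = s ↾ suc (suc k)
    dummies : ∀ a v → dummy a ≡ 3 + pair (codeWord u) (codeWord v) → v ⊏ r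
    dummies a v e with proj₂ (digit-injective (suc (pair a 0)) 0 (codeWord u) (codeWord v) e)
    dummies a [] e | _ = []
    payload : ∀ z → payloadDigit w z ≡ 3 + pair (codeWord u) (codeWord v) → v ⊏ r
    payload (zero , c) e with w ! c
    ... | suc a = dummies a v e
    payload (suc _ , c) e = curried (unpair c) e
      where
      lists : ∀ c i → curryDigit w c i ≡ 3 + pair (codeWord u) (codeWord v) → c ≡ codeWord u
      lists c i e with w ! pair 1 i
      ... | suc d with d ∸ 2
      ...   | suc m with mismatch (weave (w !_) (codeAt c)) (proj₁ (unpair m)) (proj₁ (unpair m))
      ...     | zero = proj₁ (digit-injective c (proj₂ (unpair m)) (codeWord u) (codeWord v) e)
      curried : ∀ z → curryDigit w (proj₁ z) (proj₂ z) ≡ 3 + pair (codeWord u) (codeWord v) → v ⊏ r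
      curried (c , i) e with refl ← lists c i e = curryDigit-sound (suc (suc k)) u i v φ l e
  long : ∀ n → ∃[ v ] (∃[ u ] u ⊏ x × nameOf s Lists u ↦ v) × n < length v
  long n with proj₂ φ n
  ... | (v , (u₀ , l , i , e) , h) = v , (x ↾ length u₀ , ↾-⊏ x (length u₀) , suc k , listed) , h
    where
    c = codeWord (x ↾ length u₀)
    -- The tag is chosen for its size only: as `pair` dominates its arguments, the entry sits so
    -- late in the name that the prefix of `s` used there meets both bounds of
    -- `curryDigit-complete`.
    t = suc (pair 1 i ⊔ length u₀)
    k = pair t (pair c i)
    t≤k : t ≤ suc (suc k)
    t≤k = m≤n⇒m≤1+n (m≤n⇒m≤1+n (i≤pair t (pair c i)))
    listed : nameOf s (suc k) ≡ 3 + pair c (codeWord v)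
    listed = trans (cong (payloadDigit (s ↾ suc (suc k))) (unpair-pair t (pair c i)))
      (trans (cong (λ z → curryDigit (s ↾ suc (suc k)) (proj₁ z) (proj₂ z)) (unpair-pair c i))
        (curryDigit-complete {s} {x} (suc (suc k)) u₀ v i l e
          (≤-trans (s≤s (m≤m⊔n (pair 1 i) (length u₀))) t≤k)
          (≤-trans (≤-trans (m≤n⊔m (pair 1 i) (length u₀)) (n≤1+n _)) t≤k)))

-- The value of `nameDigit` depends on the length of its word, so the oracle is cut to exactly
-- `suc k` digits, and nothing is output before these are present.
nameᶠ : Fn nat
nameᶠ = caseᶜ (sucᶜ #0 ∸ᶜ lengthᶜ fstᶜ) (sucᶜ (nameDigitᶜ (takeᶜ (sucᶜ #0) fstᶜ) #0)) (constᶜ 0)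

Computes-name : ∀ s → Computes nameᶠ s (nameOf s)
Computes-name s k = exactly {P = nameᶠ}
  (suc k , λ t l → settled t l (suc k ∸ length (s ↾ t)) refl)
  λ t → sd t (suc k ∸ length (s ↾ t)) refl
  where
  value : ∀ t → suc k ≤ t → suc (nameDigit (take (suc k) (s ↾ t)) k) ≡ suc (nameOf s k)
  value t l = cong (λ w → suc (nameDigit w k)) (take-↾ s l)
  result : ℕ → ℕ → ℕ
  result t d = caseℕ d (suc (nameDigit (take (suc k) (s ↾ t)) k)) (λ _ → 0)
  settled : ∀ t → suc k ≤ t → ∀ d → d ≡ suc k ∸ length (s ↾ t) → result t d ≡ suc (nameOf s k)
  settled t l zero    _ = value t l
  settled t l (suc d) e with () ← trans e (trans (cong (suc k ∸_) (length-applyUpTo s t)) (m≤n⇒m∸n≡0 l))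
  sd : ∀ t d → d ≡ suc k ∸ length (s ↾ t) → ∀ {v} → result t d ≡ suc v → v ≡ nameOf s k
  sd t zero e c = suc-injective (trans (sym c) (value t
    (m∸n≡0⇒m≤n (trans (cong (suc k ∸_) (sym (length-applyUpTo s t))) (sym e)))))

least : ∀ (f : ℕ → ℕ) n → f n ≡ 0 → ∃[ m ] f m ≡ 0 × (∀ j → j < m → f j ≢ 0)
least f n e with f 0 in eq
... | zero = 0 , eq , λ _ ()
least f zero    e | suc _ with () ← trans (sym eq) e
least f (suc n) e | suc _ =
  let (m , d , ne) = least (f ∘ suc) n e
  in suc m , d , λ { zero _ c → 0≢1+n (trans (sym c) eq) ; (suc j) (s≤s l) → ne j l }

-- Deterministic runs of the loop

module Loops (F : 𝔹 ⇉ 𝔹) (single : SingleValued F) where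

  infix 4 _↝_

  -- A move of the loop without the domain clauses of `L F`. Those quantify over all answers of `F`,
  -- and follow from a single one because `F` is single-valued (`to-L`).
  record _↝_ (q r : Baire) : Set where
    constructor step
    field
      answer : Baire
      asks   : val F (odds q) answer
      result : Φ (evens q) answer r

  to-L : ∀ {q r} → q ↝ r → val (L F) q r
  to-L {q} {r} (step x f φ) =
    (val⇒dom F f , λ { y (x′ , f′ , e) → r , apply y e (single f f′) }) ,
    ⟨ evens q , x ⟩ , (x , f , λ _ → refl) , apply ⟨ evens q , x ⟩ (λ _ → refl) (λ _ → refl)
    where
    apply : ∀ y {x′} → y ≗ ⟨ evens q , x′ ⟩ → x ≗ x′ → graph 𝖴 y r
    apply y {x′} e d = Φ-cong
      (λ n → sym (trans (e (n + n)) (evens-⟨,⟩ (evens q) x′ n)))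
      (λ n → trans (d n) (sym (trans (e (suc (n + n))) (odds-⟨,⟩ (evens q) x′ n))))
      (λ _ → refl) φ

  from-L : ∀ {q r} → val (L F) q r → q ↝ r
  from-L {q} (_ , y , (x , f , e) , φ) = step x f (Φ-cong
    (λ n → trans (e (n + n)) (evens-⟨,⟩ (evens q) x n))
    (λ n → trans (e (suc (n + n))) (odds-⟨,⟩ (evens q) x n)) (λ _ → refl) φ)

  ↝⇒dom : ∀ {q q′ r} → q ≗ q′ → q ↝ r → dom (L F) q′
  ↝⇒dom {q} {q′} {r} e s = dom-cong (L F) {q} {q′} e (val⇒dom (L F) {q} {r} (to-L s))

  ↝-unique : ∀ {q q′ r r′} → q ≗ q′ → q ↝ r → q′ ↝ r′ → r ≗ r′
  ↝-unique {q} {q′} e (step x f φ) (step x′ f′ φ′) =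
    IsSup-unique φ (Φ-cong (λ n → sym (e (n + n)))
      (single f′ (val-cong F (λ n → e (suc (n + n))) (λ _ → refl) f)) (λ _ → refl) φ′)

  Run : (ℕ → Baire) → ℕ → Set
  Run q n = ∀ j → j < n → q j ↝ q (suc j)

  run-unique : ∀ q q′ n → q 0 ≗ q′ 0 → Run q n → Run q′ n → q n ≗ q′ n
  run-unique q q′ zero    e l l′ = e
  run-unique q q′ (suc n) e l l′ = ↝-unique
    (run-unique q q′ n e (λ j k → l j (m<n⇒m<1+n k)) (λ j k → l′ j (m<n⇒m<1+n k)))
    (l n ≤-refl) (l′ n ≤-refl)

  finiteRun-unique : ∀ k q q′ n → q fzero ≗ q′ 0 → IsFiniteRun F k q → Run q′ n →
                     ∀ i → toℕ i ≤ n → q i ≗ q′ (toℕ i)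
  finiteRun-unique k       q q′ n       e l l′ fzero    _       = e
  finiteRun-unique (suc k) q q′ (suc n) e l l′ (fsuc i) (s≤s h) =
    finiteRun-unique k (q ∘ fsuc) (q′ ∘ suc) n (↝-unique e (from-L (l fzero)) (l′ 0 (s≤s z≤n)))
      (l ∘ fsuc) (λ j m → l′ (suc j) (s≤s m)) i h

  -- Determinism shrinks every set `Reach F (q 0) i` to the single point `q i`, which has a
  -- successor.
  ∞-dom : ∀ (q : ℕ → Baire) → (∀ i → q i ↝ q (suc i)) → dom (F ^∞) (q 0)
  ∞-dom q l i r reach = ↝⇒dom (sym ∘ reached i r reach) (l i)
    where
    reached : ∀ i r → Reach F (q 0) i r → r ≗ q i
    reached zero    r e            = e
    reached (suc i) r (r′ , a , m) = ↝-unique (reached i r′ a) (from-L m) (l i)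

  ∞-value : ∀ (q : ℕ → Baire) {s} → (∀ i → q i ↝ q (suc i)) → val (F ^∞) (q 0) s → s ≗ tuple q
  ∞-value q l (_ , q′ , e , l′ , x) k = let (i , j) = unpair k in
    trans (x k) (run-unique q′ q i e (λ j _ → from-L (l′ j)) (λ j _ → l j) j)

  module SuccessfulRun (q : ℕ → Baire) (n : ℕ) (isRun : Run q n)
                       (stop : q n 0 ≡ 0) (go : ∀ j → j < n → q j 0 ≢ 0) where

    private
      last : ∀ k q′ → q′ fzero ≗ q 0 → IsFiniteRun F k q′ → k ≤ n → q′ (fromℕ k) ≗ q k
      last k q′ e l h m = trans
        (finiteRun-unique k q′ q n e l isRun (fromℕ k) (subst (_≤ n) (sym (toℕ-fromℕ k)) h) m)
        (cong (λ j → q j m) (toℕ-fromℕ k))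

      stopped : ∀ k q′ → q′ fzero ≗ q 0 → IsFiniteRun F k q′ → ∀ i → toℕ i ≡ n → q′ i 0 ≡ 0
      stopped k q′ e l i refl = trans (finiteRun-unique k q′ q n e l isRun i ≤-refl 0) stop

    -- By determinism every competing run agrees with `q` up to `n`: a shorter one can still move,
    -- and any other meets the 0 at position `n`.
    ◇-dom : dom (F ^◇) (q 0)
    ◇-dom = noStall , λ q′ e l ne → ne n (trans (run-unique q′ q n e (λ j _ → from-L (l j)) isRun 0) stop)
      where
      noStall : ∀ k q′ → q′ fzero ≗ q 0 → IsFiniteRun F k q′ → ¬ Stalls F k q′
      noStall k q′ e l (stall , ne) with <-cmp k n
      ... | tri< h _ _ = stall (↝⇒dom (sym ∘ last k q′ e l (<⇒≤ h)) (isRun k h))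
      ... | tri≈ _ refl _ = ne (fromℕ k) (stopped k q′ e l (fromℕ k) (toℕ-fromℕ k))
      ... | tri> _ _ h    = ne (fromℕ< (m<n⇒m<1+n h)) (stopped k q′ e l _ (toℕ-fromℕ< (m<n⇒m<1+n h)))

    ◇-value : ∀ {r} → val (F ^◇) (q 0) r → r ≗ q n
    ◇-value (_ , k , q′ , e , l , (stop′ , go′) , x) m with <-cmp k n
    ... | tri< h _ _ = ⊥-elim (go k h (trans (sym (last k q′ e l (<⇒≤ h) 0)) stop′))
    ... | tri≈ _ refl _ = trans (x m) (last k q′ e l ≤-refl m)
    ... | tri> _ _ h = ⊥-elim (go′ (fromℕ< h)
      (stopped k q′ e l (inject₁ (fromℕ< h)) (trans (toℕ-inject₁ (fromℕ< h)) (toℕ-fromℕ< h))))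

    ◇-val : val (F ^◇) (q 0) (q n)
    ◇-val = ◇-dom , n , q ∘ toℕ , (λ _ → refl) ,
      (λ i → subst (λ j → val (L F) (q j) (q (suc (toℕ i)))) (sym (toℕ-inject₁ i)) (to-L (isRun (toℕ i) (toℕ<n i)))) ,
      (subst (λ j → q j 0 ≡ 0) (sym (toℕ-fromℕ n)) stop ,
       λ i → subst (λ j → q j 0 ≢ 0) (sym (toℕ-inject₁ i)) (go (toℕ i) (toℕ<n i))) ,
      λ m → cong (λ j → q j m) (sym (toℕ-fromℕ n))

  -- Iterates

  iterate-unique : ∀ n {p r r′} → val (F ^[ n ]) p r → val (F ^[ n ]) p r′ → r ≗ r′
  iterate-unique 0 e e′ n = trans (sym (e n)) (e′ n)
  iterate-unique 1 (x , f , e) (x′ , f′ , e′) n =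
    trans (e n) (trans (⟨,⟩-cong (λ _ → refl) (single f f′) n) (sym (e′ n)))
  iterate-unique (suc (suc n)) v v′ = extend (iterate-unique (suc n)) v v′
    where
    extend : ∀ {p} → (∀ {r r′} → val (F ^[ suc n ]) p r → val (F ^[ suc n ]) p r′ → r ≗ r′) →
             ∀ {r r′} → val (F ^[ suc (suc n) ]) p r → val (F ^[ suc (suc n) ]) p r′ → r ≗ r′
    extend unique (_ , q , (_ , s , i , u) , x , f , e) (_ , q′ , (_ , s′ , i′ , u′) , x′ , f′ , e′) m =
      trans (e m) (trans (⟨,⟩-cong (λ n → q≗q′ (n + n))
        (single f (val-cong F (λ n → sym (q≗q′ (suc (n + n)))) (λ _ → refl) f′)) m) (sym (e′ m)))
      where
      q≗q′ : q ≗ q′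
      q≗q′ = graph-unique 𝖴 {s} u (graph-cong 𝖴 {s′} {s} (unique i′ i) (λ _ → refl) u′)

  -- The common witness for `F ^∞` and `F ^ω`: the states are the value of the former, the stages
  -- just before each application of `𝖴` that of the latter.
  record Trace (p : Baire) : Set where
    field
      state : ℕ → Baire
      start : state 0 ≗ p
      moves : ∀ n → state n ↝ state (suc n)

    answer : ℕ → Baire
    answer n = _↝_.answer (moves n)

    asks : ∀ n → val F (odds (state n)) (answer n)
    asks n = _↝_.asks (moves n)

    -- This is what `𝖴` is asked: the current name with the answer of `F`, and so the value of
    -- `F ^[ suc n ]`.
    question : ℕ → Baire
    question n = ⟨ evens (state n) , answer n ⟩

    𝖴-question : ∀ n → graph 𝖴 (question n) (state (suc n))
    𝖴-question n = Φ-cong (sym ∘ evens-⟨,⟩ (evens (state n)) (answer n))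
      (sym ∘ odds-⟨,⟩ (evens (state n)) (answer n)) (λ _ → refl) (_↝_.result (moves n))

    iterate : ℕ → Baire
    iterate zero    = p
    iterate (suc n) = question n

    iterate-val : ∀ n → val (F ^[ n ]) p (iterate n)
    iterate-val 0 = λ _ → refl
    iterate-val 1 = answer 0 , val-cong F (λ n → start (suc (n + n))) (λ _ → refl) (asks 0) ,
      ⟨,⟩-cong (λ n → start (n + n)) (λ _ → refl)
    iterate-val (suc (suc n)) = extend (iterate-val (suc n))
      where
      extend : val (F ^[ suc n ]) p (question n) → val (F ^[ suc (suc n) ]) p (question (suc n))
      extend v =
        (D , λ y (_ , s , i , u) → dom-cong F (λ m → next-state y s i u (suc (m + m))) (val⇒dom F (asks (suc n)))) ,
        state (suc n) , (D , question n , v , 𝖴-question n) ,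
        answer (suc n) , asks (suc n) , λ _ → refl
        where
        next-state : ∀ y s → val (F ^[ suc n ]) p s → graph 𝖴 s y → state (suc n) ≗ y
        next-state y s i u = graph-unique 𝖴 {question n} (𝖴-question n)
          (graph-cong 𝖴 {s} {question n} (iterate-unique (suc n) i v) (λ _ → refl) u)
        D : dom (F ^[ suc n ]) p × (∀ s → val (F ^[ suc n ]) p s → ∃[ r ] graph 𝖴 s r)
        D = val⇒dom (F ^[ suc n ]) v , λ s i →
          state (suc n) , graph-cong 𝖴 {question n} {s} (iterate-unique (suc n) v i) (λ _ → refl) (𝖴-question n)

    ω-val : val (F ^ω) p (tuple iterate)
    ω-val = (λ n → val⇒dom (F ^[ n ]) (iterate-val n)) , iterate , iterate-val , λ _ → refl

    ω-value : ∀ {s} → val (F ^ω) p s → s ≗ tuple iterate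
    ω-value (_ , r , v , x) k = let (i , j) = unpair k in trans (x k) (iterate-unique i (v i) (iterate-val i) j)

    ∞-val : val (F ^∞) p (tuple state)
    ∞-val = val-cong (F ^∞) {state 0} {p} start (λ _ → refl)
      (∞-dom state moves , state , (λ _ → refl) , (λ i → to-L (moves i)) , λ _ → refl)

  module Solvable (problem : IsProblem F) where

    answerTo : ∀ {q} → dom F q → ∃[ x ] val F q x
    answerTo {q} d = let (_ , _ , x , _ , f) = proj₂ problem q q (λ _ → refl) d in x , f

    successor : ∀ {q} → dom (L F) q → ∃[ r ] q ↝ r
    successor {q} (d , u) =
      let (x , f) = answerTo d ; y = ⟨ evens q , x ⟩ ; (r , φ) = u y (x , f , λ _ → refl)
      in r , step x f (Φ-cong (evens-⟨,⟩ (evens q) x) (odds-⟨,⟩ (evens q) x) (λ _ → refl) φ)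

    ∞-trace : ∀ {p} → dom (F ^∞) p → Trace p
    ∞-trace {p} d = record
      { state = λ n → proj₁ (states n)
      ; start = λ _ → refl
      ; moves = λ n → proj₂ (after n)
      }
      where
      states : ∀ n → ∃[ q ] Reach F p n q
      after  : ∀ n → ∃[ r ] proj₁ (states n) ↝ r
      after n = successor (d n (proj₁ (states n)) (proj₂ (states n)))
      states zero    = p , λ _ → refl
      states (suc n) = proj₁ (after n) , proj₁ (states n) , proj₂ (states n) , to-L (proj₂ (after n))

    -- Membership in the domain of `F ^[ suc (suc n) ]` says both that `𝖴` is defined on the value
    -- of `F ^[ suc n ]` and that `F` can answer the question contained in the result; this is
    -- exactly one more stage.
    ω-trace : ∀ {p} → dom (F ^ω) p → Trace p
    ω-trace {p} d = record
      { state = λ n → proj₁ (stages n)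
      ; start = λ _ → refl
      ; moves = λ n → let (q , x , f , _) = stages n in
          step x f (Φ-cong (evens-⟨,⟩ (evens q) x) (odds-⟨,⟩ (evens q) x) (λ _ → refl) (proj₂ (outcome n)))
      }
      where
      stages : ∀ n → ∃[ q ] ∃[ x ] val F (odds q) x × val (F ^[ suc n ]) p ⟨ evens q , x ⟩
      outcome : ∀ n → ∃[ r ] graph 𝖴 ⟨ evens (proj₁ (stages n)) , proj₁ (proj₂ (stages n)) ⟩ r
      outcome n = let (q , x , f , i) = stages n in proj₂ (proj₁ (d (suc (suc n)))) ⟨ evens q , x ⟩ i
      stages zero    = let (x , f) = answerTo (d 1) in p , x , f , x , f , λ _ → refl
      stages (suc n) =
        let (q , x , f , i) = stages n
            (r , u)   = outcome n
            s         = proj₁ (d (suc (suc n))) , ⟨ evens q , x ⟩ , i , u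
            (x′ , f′) = answerTo (proj₂ (d (suc (suc n))) r s)
        in r , x′ , f′ , d (suc (suc n)) , r , s , x′ , f′ , λ _ → refl

    module Classical (em : ExcludedMiddle 0ℓ) where

      -- The default `q` makes the trajectory total. From a start in the domain of `F ^◇` it can be
      -- taken only after the run has halted (`isRun`).
      advance : Baire → Baire
      advance q with em {dom (L F) q}
      ... | yes d = proj₁ (successor {q} d)
      ... | no _  = q

      trajectory : Baire → ℕ → Baire
      trajectory q zero    = q
      trajectory q (suc n) = advance (trajectory q n)

      module Halting {q₀ : Baire} (d : dom (F ^◇) q₀) where

        private
          q = trajectory q₀

        isRun : ∀ n → (∀ j → j < n → q j 0 ≢ 0) → Run q n
        isRun (suc n) ne j l with m≤n⇒m<n∨m≡n (≤-pred l)
        ... | inj₁ k = isRun n (λ i m → ne i (m<n⇒m<1+n m)) j k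
        ... | inj₂ refl with em {dom (L F) (q n)}
        ...   | yes e = proj₂ (successor {q n} e)
        ...   | no ¬e = ⊥-elim (proj₁ d n (q ∘ toℕ) (λ _ → refl)
          (λ i → subst (λ m → val (L F) (q m) (q (suc (toℕ i)))) (sym (toℕ-inject₁ i))
                   (to-L (isRun n (λ i m → ne i (m<n⇒m<1+n m)) (toℕ i) (toℕ<n i))))
          ((λ e → ¬e (subst (dom (L F) ∘ q) (toℕ-fromℕ n) e)) , λ i → ne (toℕ i) (toℕ<n i)))

        -- Without a 0 the trajectory would go on moving forever, since being stuck would be a
        -- stall; it would then be an infinite unsuccessful run, which the domain forbids as well.
        halts : ∃[ n ] q n 0 ≡ 0 × (∀ j → j < n → q j 0 ≢ 0)
        halts with em {∃[ n ] q n 0 ≡ 0}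
        ... | no never    = ⊥-elim (proj₂ d q (λ _ → refl)
          (λ i → to-L (isRun (suc i) (λ j _ e → never (j , e)) i ≤-refl)) (λ i e → never (i , e)))
        ... | yes (n , e) = least (λ n → q n 0) n e

-- The self-reproducing machine

rows : Baire → Baire → Baire → Baire → ℕ → Baire
rows r₀ r₁ r₂ r₃ 0 = r₀
rows r₀ r₁ r₂ r₃ 1 = r₁
rows r₀ r₁ r₂ r₃ 2 = r₂
rows r₀ r₁ r₂ r₃ _ = r₃

rowᶠ : (R₀ R₁ R₂ R₃ : Fn (A ⊗ nat)) → Fn (A ⊗ (nat ⊗ nat))
rowᶠ R₀ R₁ R₂ R₃ =
  caseᶠ (fstᶜ ∘ᶜ #0) (R₀ ∘ᶠ (fstᶜ ,ᶜ sndᶜ ∘ᶜ #0))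
    (caseᶠ #0 (R₁ ∘ᶠ (fstᶜ ∘ᶜ fstᶜ ,ᶜ sndᶜ ∘ᶜ #1))
      (caseᶠ #0 (R₂ ∘ᶠ (fstᶜ ∘ᶜ fstᶜ ∘ᶜ fstᶜ ,ᶜ sndᶜ ∘ᶜ #2))
        (R₃ ∘ᶠ (fstᶜ ∘ᶜ fstᶜ ∘ᶜ fstᶜ ∘ᶜ fstᶜ ,ᶜ sndᶜ ∘ᶜ #3))))

rowsᶠ : (R₀ R₁ R₂ R₃ : Fn (A ⊗ nat)) → Fn (A ⊗ nat)
rowsᶠ R₀ R₁ R₂ R₃ = rowᶠ R₀ R₁ R₂ R₃ ∘ᶠ (fstᶜ ,ᶜ unpairᶜ sndᶜ)

Yields-rows : ∀ {R₀ R₁ R₂ R₃ : Fn (A ⊗ nat)} {p a} (r₀ r₁ r₂ r₃ : Baire) →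
              (∀ j → Yields R₀ p (a , j) (r₀ j)) → (∀ j → Yields R₁ p (a , j) (r₁ j)) →
              (∀ j → Yields R₂ p (a , j) (r₂ j)) → (∀ j → Yields R₃ p (a , j) (r₃ j)) →
              ∀ k → Yields (rowsᶠ R₀ R₁ R₂ R₃) p (a , k) (tuple (rows r₀ r₁ r₂ r₃) k)
Yields-rows {R₀ = R₀} {R₁} {R₂} {R₃} {p} {a} r₀ r₁ r₂ r₃ y₀ y₁ y₂ y₃ k =
  Yields-∘ {P = rowᶠ R₀ R₁ R₂ R₃} {g = fstᶜ ,ᶜ unpairᶜ sndᶜ} (row (unpair k))
  where
  row : ∀ z → Yields (rowᶠ R₀ R₁ R₂ R₃) p (a , z) (rows r₀ r₁ r₂ r₃ (proj₁ z) (proj₂ z))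
  row (0 , j) = Yields-zero refl (Yields-∘ {P = R₀} (y₀ j))
  row (1 , j) = Yields-suc refl (Yields-zero refl (Yields-∘ {P = R₁} (y₁ j)))
  row (2 , j) = Yields-suc refl (Yields-suc refl (Yields-zero refl (Yields-∘ {P = R₂} (y₂ j))))
  row (suc (suc (suc _)) , j) = Yields-suc refl (Yields-suc refl (Yields-suc refl (Yields-∘ {P = R₃} (y₃ j))))

-- The program of a machine reads the state at the even and the answer of `F` at the odd positions
-- of its oracle, hence the doubled index.
stateIndexᶜ : ℕ → Γ ⇒ nat → Γ ⇒ nat
stateIndexᶜ c J = pairᶜ (constᶜ c) J +ᶜ pairᶜ (constᶜ c) J

askStateᶠ : ℕ → A ⇒ nat → Fn A
askStateᶠ c J = askᶠ (stateIndexᶜ c J)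

applyPointᶠ : Fn (A ⊗ nat)
applyPointᶠ = applyᶠ (askStateᶠ 2 (#0 +ᶜ #0)) (askᶠ (sucᶜ (#0 +ᶜ #0)))

-- R₀ and R₂ compute the next header and the next point.  The parameter p and the
-- program in row 1, which makes the machine reproduce itself, are passed on.
module Machine (R₀ R₂ : Fn ((nat ⊗ nat) ⊗ nat)) (arg : Fn nat) where

  configᶠ : Fn nat
  configᶠ = weaveᶠ nameᶠ arg

  nextRowsᶠ : Fn ((nat ⊗ nat) ⊗ nat)
  nextRowsᶠ = rowsᶠ R₀ (askStateᶠ 1 #0) R₂ (askStateᶠ 3 #0)

  nextᶠ : Fn nat
  nextᶠ = bindᶠ (askStateᶠ 0 (constᶜ 0)) (bindᶠ (askStateᶠ 2 (constᶜ 0))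
    (nextRowsᶠ ∘ᶠ ((#1 ,ᶜ #0) ,ᶜ fstᶜ ∘ᶜ fstᶜ)))

  transition : PartialFunction
  transition = graphOf configᶠ ∘ᵖ graphOf nextᶠ

  transition-computable : IsComputable transition
  transition-computable = ∘ᵖ-computable {graphOf configᶠ} {graphOf nextᶠ}
    (graphOf-computable configᶠ) (graphOf-computable nextᶠ)

  abstract
    code : nat ⇒ nat
    code = proj₁ (computableName {transition} transition-computable)

    code-Φ : ∀ {p r} → graph transition p r → Φ (run code) p r
    code-Φ = proj₂ (computableName {transition} transition-computable)

  -- With the header in row 0, digit 0 of the state is `h`, so the flag of the name tells whether
  -- `h` is 0. Row 1 is where `nameOf` looks for the program.
  contents : ℕ → Baire → Baire → ℕ → Baire
  contents h u p = rows (λ _ → h) (run code) u p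

  state : ℕ → Baire → Baire → Baire
  state h u p = tuple (contents h u p)

  config : ℕ → Baire → Baire → Baire → Baire
  config h u p a = ⟨ nameOf (state h u p) , a ⟩

  Yields-askState : ∀ {h u p x} c {A} {J : A ⇒ nat} {a} →
                    Yields (askStateᶠ c J) ⟨ state h u p , x ⟩ a (contents h u p c (run J a))
  Yields-askState {h} {u} {p} {x} c {J = J} {a} = Yields-≡ {P = askStateᶠ c J}
    (trans (evens-⟨,⟩ (state h u p) x (pair c (run J a))) (tuple-pair (contents h u p) c (run J a)))
    (Yields-ask {g = stateIndexᶜ c J})

  -- The program copies row 1, which holds its own name, into the next state; `nameOf` then curries
  -- that same program at the new state.
  config-transition : ∀ {h h′ u u′ p x a′} →
    (∀ j → Yields R₀ ⟨ state h u p , x ⟩ ((h , u 0) , j) h′) →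
    (∀ j → Yields R₂ ⟨ state h u p , x ⟩ ((h , u 0) , j) (u′ j)) →
    Computes arg (state h′ u′ p) a′ →
    Φ (nameOf (state h u p)) x (config h′ u′ p a′)
  config-transition {h} {h′} {u} {u′} {p} {x} {a′} y₀ y₂ z =
    nameOf-Φ (Φ-cong (λ j → sym (tuple-pair (contents h u p) 1 j)) (λ _ → refl) (λ _ → refl)
      (code-Φ (state h′ u′ p , next-state ,
        Computes-weave {nameᶠ} {arg} (Computes-name (state h′ u′ p)) z)))
    where
    next-state : Computes nextᶠ ⟨ state h u p , x ⟩ (state h′ u′ p)
    next-state k = Yields-bind (Yields-askState {h} {u} {p} {x} 0) (Yields-bind (Yields-askState {h} {u} {p} {x} 2)
      (Yields-∘ {P = nextRowsᶠ} (Yields-rows (λ _ → h′) (run code) u′ p y₀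
        (λ j → Yields-askState {h} {u} {p} {x} 1) y₂ (λ j → Yields-askState {h} {u} {p} {x} 3) k)))

  startᶠ : A ⇒ nat → Fn (A ⊗ nat) → Fn (A ⊗ nat) → Fn (A ⊗ nat)
  startᶠ H U P = composeᶠ configᶠ (rowsᶠ (pureᶠ (H ∘ᶜ fstᶜ)) (pureᶠ (code ∘ᶜ sndᶜ)) U P)

  Yields-start : ∀ {H : A ⇒ nat} {U P : Fn (A ⊗ nat)} {s a u p a′} →
                 (∀ j → Yields U s (a , j) (u j)) → (∀ j → Yields P s (a , j) (p j)) →
                 Computes arg (state (run H a) u p) a′ →
                 ∀ k → Yields (startᶠ H U P) s (a , k) (config (run H a) u p a′ k)
  Yields-start {H = H} {U} {P} {s} {a} {u} {p} {a′} y z w k =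
    Yields-compose {P = configᶠ} {q = state (run H a) u p}
      (Yields-rows (λ _ → run H a) (run code) u p
        (λ j → Yields-pure {g = H ∘ᶜ fstᶜ}) (λ j → Yields-pure {g = code ∘ᶜ sndᶜ}) y z)
      (Computes-weave {nameᶠ} {arg} (Computes-name (state (run H a) u p)) w k)

  config-payload : ∀ h u p a c j →
    undummy (config h u p a (payloadAt (pair c j) + payloadAt (pair c j))) ≡ contents h u p c j
  config-payload h u p a c j = trans (cong undummy (evens-⟨,⟩ (nameOf (state h u p)) a (payloadAt (pair c j))))
    (trans (nameOf-payload (state h u p) (pair c j)) (tuple-pair (contents h u p) c j))

  Yields-applyPoint : ∀ {h u p x r A} {b : ⟦ A ⟧} → Φ (evens u) x r →
    ∀ k → Yields (applyPointᶠ {A}) ⟨ state h u p , x ⟩ (b , k) (r k)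
  Yields-applyPoint {h} {u} {p} {x} {r} {A} {b} φ =
    Yields-apply {A} {askStateᶠ 2 (#0 +ᶜ #0)} {askᶠ (sucᶜ (#0 +ᶜ #0))} {a = b}
      (λ j → Yields-askState {h} {u} {p} {x} 2 {A ⊗ nat} {#0 +ᶜ #0} {b , j})
      (λ j → Yields-≡ {P = askᶠ {A ⊗ nat} (sucᶜ (#0 +ᶜ #0))} (odds-⟨,⟩ (state h u p) x j)
               (Yields-ask {g = sucᶜ (#0 +ᶜ #0)} {a = b , j})) φ

  -- The index is `payloadAt (pair c J)` doubled: a configuration has its name at the even
  -- positions, and there the dummy entry stores the digit. This is the only access of the
  -- postprocessing to the simulated states.
  readᶠ : ℕ → A ⇒ nat → A ⇒ nat → Fn A
  readᶠ c I J = bindᶠ (askᶠ (pairᶜ I (letᶜ (sucᶜ (pairᶜ (constᶜ 0) (pairᶜ (constᶜ c) J))) (#0 +ᶜ #0))))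
                      (pureᶠ (undummyᶜ #0))

  Yields-read : ∀ {c A} {I J : A ⇒ nat} {s a h u p b} → (∀ k → s (pair (run I a) k) ≡ config h u p b k) →
                Yields (readᶠ c I J) s a (contents h u p c (run J a))
  Yields-read {c} {A} {I} {J} {s} {a} {h} {u} {p} {b} e = Yields-≡ {P = readᶠ c I J}
    (trans (cong undummy (e _)) (config-payload h u p b c (run J a)))
    (Yields-bind (Yields-ask {g = pairᶜ I (letᶜ (sucᶜ (pairᶜ (constᶜ 0) (pairᶜ (constᶜ c) J))) (#0 +ᶜ #0))})
      (Yields-pure {g = undummyᶜ #0}))

Computes-tuple : ∀ {P : Fn (nat ⊗ nat)} {s} {q : ℕ → Baire} →
                 (∀ i j → Yields P s (i , j) (q i j)) → Computes (P ∘ᶠ unpairᶜ idᶜ) s (tuple q)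
Computes-tuple {P} y k = Yields-∘ {P = P} {g = unpairᶜ idᶜ} (y (proj₁ (unpair k)) (proj₂ (unpair k)))

Computes-id : ∀ p → Computes (askᶠ idᶜ) p p
Computes-id p k = Yields-ask {g = idᶜ}

-- The two reductions that need no excluded middle

module Reductions (F : 𝔹 ⇉ 𝔹) (single : SingleValued F) (problem : IsProblem F) where

  open Loops F single
  open Solvable problem

  module Unfolding where

    namesᶠ pointsᶠ unfoldᶠ : Fn (nat ⊗ nat)
    namesᶠ  = askᶠ (pairᶜ (sucᶜ fstᶜ) (#0 +ᶜ #0))
    pointsᶠ = askᶠ (pairᶜ (sucᶜ fstᶜ) (sucᶜ (#0 +ᶜ #0)))
    -- Component 0 of an output of `F ^ω` is the input, hence already state 0; component `suc n`
    -- becomes state `suc n` by applying `𝖴`.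
    unfoldᶠ = caseᶠ fstᶜ (askᶠ (pairᶜ (constᶜ 0) sndᶜ)) (applyᶠ namesᶠ pointsᶠ ∘ᶠ (#0 ,ᶜ sndᶜ ∘ᶜ fstᶜ))

    statesᶠ : Fn nat
    statesᶠ = unfoldᶠ ∘ᶠ unpairᶜ idᶜ

    Computes-states : ∀ {p s} (T : Trace p) → s ≗ tuple (Trace.iterate T) → Computes statesᶠ s (tuple (Trace.state T))
    Computes-states {p} {s} T e = Computes-tuple {unfoldᶠ} unfolded
      where
      open Trace T
      digit : ∀ i j → s (pair i j) ≡ iterate i j
      digit i j = trans (e (pair i j)) (tuple-pair iterate i j)
      unfolded : ∀ i j → Yields unfoldᶠ s (i , j) (state i j)
      unfolded zero j = Yields-zero refl (Yields-≡ {P = askᶠ (pairᶜ (constᶜ 0) sndᶜ)}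
        (trans (digit 0 j) (sym (start j))) (Yields-ask {g = pairᶜ (constᶜ 0) sndᶜ}))
      unfolded (suc n) j = Yields-suc refl (Yields-∘ {P = applyᶠ namesᶠ pointsᶠ} {g = #0 ,ᶜ sndᶜ ∘ᶜ fstᶜ}
        (Yields-apply {Q = namesᶠ} {pointsᶠ} {a = n}
          (λ m → Yields-≡ {P = namesᶠ} (digit (suc n) (m + m)) (Yields-ask {g = pairᶜ (sucᶜ fstᶜ) (#0 +ᶜ #0)}))
          (λ m → Yields-≡ {P = pointsᶠ} (digit (suc n) (suc (m + m))) (Yields-ask {g = pairᶜ (sucᶜ fstᶜ) (sucᶜ (#0 +ᶜ #0))}))
          (𝖴-question n) j))

    ∞≤ω : F ^∞ ≤sW F ^ω
    ∞≤ω = graphOf statesᶠ , graphOf (askᶠ idᶜ) , graphOf-computable statesᶠ , graphOf-computable (askᶠ idᶜ) ,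
      λ G realizes p x p≗x d →
        let T = ∞-trace d
            (r , g , y , r≗y , v) = realizes p x p≗x (val⇒dom (F ^ω) (Trace.ω-val T))
        in tuple (Trace.state T) ,
           (r , (p , Computes-id p , g) , Computes-states T (λ k → trans (r≗y k) (Trace.ω-value T v k))) ,
           tuple (Trace.state T) , (λ _ → refl) , Trace.∞-val T

  module Simulation (R₀ R₂ : Fn ((nat ⊗ nat) ⊗ nat)) (arg : Fn nat) where

    open Machine R₀ R₂ arg public

    config-↝ : ∀ {h h′ u u′ p a x a′} → val F a x →
      (∀ j → Yields R₀ ⟨ state h u p , x ⟩ ((h , u 0) , j) h′) →
      (∀ j → Yields R₂ ⟨ state h u p , x ⟩ ((h , u 0) , j) (u′ j)) →
      Computes arg (state h′ u′ p) a′ →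
      config h u p a ↝ config h′ u′ p a′
    config-↝ {h} {h′} {u} {u′} {p} {a} {x} {a′} f y₀ y₂ z =
      step x (val-cong F (sym ∘ odds-⟨,⟩ (nameOf (state h u p)) a) (λ _ → refl) f)
        (Φ-cong (sym ∘ evens-⟨,⟩ (nameOf (state h u p)) a) (λ _ → refl) (λ _ → refl)
          (config-transition {h} {h′} {u} {u′} {p} {x} y₀ y₂ z))

  -- A countdown: the header is the number of steps that remain to be made, and
  -- the last step skips the application of 𝖴.
  module Countdown where

    -- Locates digit `j` of `⟨ evens u , x ⟩` in the oracle `⟨ state h u p , x ⟩`: odd digits keep
    -- their place, even ones stand at the same index `j` of row 2.
    pairIndexᶜ : Γ ⊗ nat ⇒ nat
    pairIndexᶜ = caseᶜ (sndᶜ ∘ᶜ halveᶜ #0) (stateIndexᶜ 2 #0) #1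

    pairIndexOf : ℕ → ℕ
    pairIndexOf j = caseℕ (proj₂ (halve j)) (pair 2 j + pair 2 j) (λ _ → j)

    argᶠ : Fn nat
    argᶠ = askᶠ (pairᶜ (constᶜ 2) (sucᶜ (idᶜ +ᶜ idᶜ)))

    headerᶠ pointᶠ : Fn ((nat ⊗ nat) ⊗ nat)
    headerᶠ = pureᶠ (predᶜ (fstᶜ ∘ᶜ fstᶜ))
    -- Header 1 marks the last step, so the case distinction is on the predecessor.
    pointᶠ  = caseᶠ (predᶜ (fstᶜ ∘ᶜ fstᶜ)) (askᶠ pairIndexᶜ) (applyPointᶠ ∘ᶠ fstᶜ)

    open Simulation headerᶠ pointᶠ argᶠ

    Computes-arg : ∀ h u p → Computes argᶠ (state h u p) (odds u)
    Computes-arg h u p k = Yields-≡ {P = argᶠ} (tuple-pair (contents h u p) 2 (suc (k + k)))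
      (Yields-ask {g = pairᶜ (constᶜ 2) (sucᶜ (idᶜ +ᶜ idᶜ))})

    pairIndex : ∀ {h u p x} j → ⟨ state h u p , x ⟩ (pairIndexOf j) ≡ ⟨ evens u , x ⟩ j
    pairIndex {h} {u} {p} {x} j = at j (parity j)
      where
      at : ∀ j → Parity j → ⟨ state h u p , x ⟩ (pairIndexOf j) ≡ ⟨ evens u , x ⟩ j
      at _ (even n) = trans
        (cong (λ z → ⟨ state h u p , x ⟩ (caseℕ (proj₂ z) (pair 2 (n + n) + pair 2 (n + n)) (λ _ → n + n)))
              (halve-even n))
        (trans (evens-⟨,⟩ (state h u p) x (pair 2 (n + n)))
          (trans (tuple-pair (contents h u p) 2 (n + n)) (sym (evens-⟨,⟩ (evens u) x n))))
      at _ (odd n) = trans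
        (cong (λ z → ⟨ state h u p , x ⟩ (caseℕ (proj₂ z) (pair 2 (suc (n + n)) + pair 2 (suc (n + n))) (λ _ → suc (n + n))))
              (halve-odd n))
        (trans (odds-⟨,⟩ (state h u p) x n) (sym (odds-⟨,⟩ (evens u) x n)))

    Yields-last : ∀ {u p x b} k → Yields pointᶠ ⟨ state 1 u p , x ⟩ ((1 , b) , k) (⟨ evens u , x ⟩ k)
    Yields-last {u} {p} {x} {b} k = Yields-zero {g = predᶜ (fstᶜ ∘ᶜ fstᶜ)} {askᶠ pairIndexᶜ} {applyPointᶠ ∘ᶠ fstᶜ} refl
      (Yields-≡ {P = askᶠ pairIndexᶜ} (pairIndex {1} {u} {p} {x} k) (Yields-ask {g = pairIndexᶜ}))

    Yields-inner : ∀ {m u p x r b} → Φ (evens u) x r → ∀ k →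
                   Yields pointᶠ ⟨ state (suc (suc m)) u p , x ⟩ ((suc (suc m) , b) , k) (r k)
    Yields-inner {m} {u} {p} {x} {r} {b} φ k =
      Yields-suc {g = predᶜ (fstᶜ ∘ᶜ fstᶜ)} {askᶠ pairIndexᶜ} {applyPointᶠ ∘ᶠ fstᶜ} {n = m} refl
        (Yields-∘ {P = applyPointᶠ} {g = fstᶜ}
          (Yields-applyPoint {suc (suc m)} {u} {p} {x} {r} {nat ⊗ nat} {suc (suc m) , b} φ k))

    module _ {p : Baire} (T : Trace p) where

      open Trace T renaming (state to states)

      -- Header 0 ends the countdown, and the point is then a value of `F ^[ n ]` instead of a
      -- state. This includes `n ≡ 0`, where the run halts without a move.
      point : ℕ → ℕ → ℕ → Baire
      point n j h = caseℕ h (iterate n) (λ _ → states j)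

      configs : ℕ → ℕ → ℕ → Baire
      configs n j h = config h (point n j h) p (odds (point n j h))

      countdown : ℕ → ℕ → Baire
      countdown n j = configs n j (n ∸ j)

      configs-↝ : ∀ n j m → (m ≡ 0 → n ≡ suc j) → configs n j (suc m) ↝ configs n (suc j) m
      configs-↝ n j m last = config-↝ {suc m} {m} {states j} {point n (suc j) m} (asks j)
        (λ k → Yields-pure {g = predᶜ (fstᶜ ∘ᶜ fstᶜ)}) (new m last)
        (Computes-arg m (point n (suc j) m) p)
        where
        new : ∀ m → (m ≡ 0 → n ≡ suc j) → ∀ k →
              Yields pointᶠ ⟨ state (suc m) (states j) p , answer j ⟩ ((suc m , states j 0) , k) (point n (suc j) m k)
        new zero last k = subst (λ n → Yields pointᶠ _ ((1 , states j 0) , k) (iterate n k)) (sym (last refl))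
          (Yields-last {states j} {p} {answer j} {states j 0} k)
        new (suc m) _ k = Yields-inner {m} {states j} {p} {answer j} (_↝_.result (moves j)) k

      remaining : ∀ {j n} → j < n → n ∸ j ≡ suc (n ∸ suc j)
      remaining l = +-∸-assoc 1 l

      countdown-run : ∀ n → Run (countdown n) n
      countdown-run n j l = subst (λ h → configs n j h ↝ countdown n (suc j)) (sym (remaining l))
        (configs-↝ n j (n ∸ suc j) (λ e → ≤-antisym (m∸n≡0⇒m≤n e) l))

      module _ (n : ℕ) where
        -- The first digit of a configuration reduces to 0 or 1 according to its header.
        open SuccessfulRun (countdown n) n (countdown-run n)
          (cong (λ h → caseℕ h 0 (λ _ → 1)) (n∸n≡0 n))
          (λ j l e → 1+n≢0 (trans (sym (cong (λ h → caseℕ h 0 (λ _ → 1)) (remaining l))) e)) public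

      countdown-end : ∀ n → countdown n n ≡ config 0 (iterate n) p (odds (iterate n))
      countdown-end n = cong (configs n n) (n∸n≡0 n)

      countdown-start : ∀ n → p ≗ point n 0 n
      countdown-start zero    _ = refl
      countdown-start (suc n) = sym ∘ start

    startsᶠ : Fn (nat ⊗ nat)
    startsᶠ = startᶠ idᶜ (askᶠ #0) (askᶠ #0)

    Computes-starts : ∀ {p} (T : Trace p) → Computes (startsᶠ ∘ᶠ unpairᶜ idᶜ) p (tuple (λ n → countdown T n 0))
    Computes-starts {p} T = Computes-tuple {startsᶠ} λ n →
      Yields-start {H = idᶜ} {askᶠ #0} {askᶠ #0} {s = p} {a = n} {u = point T n 0 n} {p = p}
      (λ j → Yields-≡ {P = askᶠ {nat ⊗ nat} #0} (countdown-start T n j) (Yields-ask {g = #0}))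
      (λ j → Yields-ask {g = #0})
      (Computes-arg n (point T n 0 n) p)

    Computes-result : ∀ {p} (T : Trace p) {r} → (∀ n → component n r ≗ countdown T n n) →
                      Computes (readᶠ 2 fstᶜ sndᶜ ∘ᶠ unpairᶜ idᶜ) r (tuple (Trace.iterate T))
    Computes-result {p} T {r} e = Computes-tuple {readᶠ 2 fstᶜ sndᶜ} λ n j →
      Yields-read {2} {I = fstᶜ} {sndᶜ} {h = 0} {Trace.iterate T n} {p} {odds (Trace.iterate T n)}
        (λ k → trans (e n k) (cong (λ q → q k) (countdown-end T n)))

    ω≤◇ : F ^ω ≤sW parallelization (F ^◇)
    ω≤◇ = graphOf (readᶠ 2 fstᶜ sndᶜ ∘ᶠ unpairᶜ idᶜ) , graphOf (startsᶠ ∘ᶠ unpairᶜ idᶜ) ,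
      graphOf-computable (readᶠ 2 fstᶜ sndᶜ ∘ᶠ unpairᶜ idᶜ) , graphOf-computable (startsᶠ ∘ᶠ unpairᶜ idᶜ) ,
      λ G realizes p x p≗x d →
        let T = ω-trace (dom-cong (F ^ω) (sym ∘ p≗x) d)
            starts = λ n → countdown T n 0
            (r , g , y , r≗y , v) = realizes (tuple starts) starts (tuple-pair starts) (◇-dom T)
        in tuple (Trace.iterate T) ,
           (r , (tuple starts , Computes-starts T , g) ,
            Computes-result T (λ n k → trans (r≗y n k) (◇-value T n (v n) k))) ,
           tuple (Trace.iterate T) , (λ _ → refl) , val-cong (F ^ω) p≗x (λ _ → refl) (Trace.ω-val T)

-- All runs of the diamond in one infinite loop

Sound-bind : ∀ {P : Fn A} {Q : Fn (A ⊗ nat)} {p a v u} →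
             Sound P p a v → Sound Q p (a , v) u → Sound (bindᶠ P Q) p a u
Sound-bind {P = P} {Q} {p} {a} s s′ t e with run P (p ↾ t , a) in eq
... | suc v with refl ← s t eq = s′ t e

Sound-case : ∀ {g : A ⇒ nat} {P : Fn A} {Q : Fn (A ⊗ nat)} {p a v} →
             (run g a ≡ 0 → Sound P p a v) → (∀ n → run g a ≡ suc n → Sound Q p (a , n) v) →
             Sound (caseᶠ g P Q) p a v
Sound-case {g = g} {P} {Q} {p} {a} z s t = at (run g a) refl
  where
  at : ∀ m → run g a ≡ m → ∀ {v′} → caseℕ m (run P (p ↾ t , a)) (λ n → run Q (p ↾ t , (a , n))) ≡ suc v′ → v′ ≡ _
  at zero    e = z e t
  at (suc n) e = s n e t

Sound-fail : ∀ {p} {a : ⟦ A ⟧} {v} → Sound {A} (constᶜ 0) p a v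
Sound-fail t ()

-- The word function is fed with longer and longer words of zeros until digit `k` of its output
-- appears; `constᶜ 1` codes the defined digit 0.
zero-outputᶠ : list nat ⇒ list nat → Fn nat
zero-outputᶠ φ = searchᶠ (lookupᶜ (φ ∘ᶜ genᶜ (constᶜ 1) (#0 ∘ᶜ sndᶜ)) (fstᶜ ∘ᶜ sndᶜ))

Computes-zero-output : ∀ φ {c} → IsSup (λ v → ∃[ w ] w ⊏ (λ _ → 0) × v ≡ run φ w) c → ∀ s → Computes (zero-outputᶠ φ) s c
Computes-zero-output φ {c} (upper , long) s k with long k
... | (_ , (w , w⊏0 , refl) , l) = Yields-search {a = k} (length w)
  (0 , λ _ _ e → !-< (run φ w) l (trans (cong (λ u → run φ u ! k) (trans (⊏-↾ w⊏0) (sym (zeros (length w))))) e))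
  (λ n t e → ⊏-! (upper _ (_ , subst (_⊏ (λ _ → 0)) (sym (zeros n)) (↾-⊏ (λ _ → 0) n) , refl)) k e)
  where
  zeros : ∀ n → gen (λ _ → 1) n ≡ (λ _ → 0) ↾ n
  zeros zero    = refl
  zeros (suc n) = cong (0 ∷_) (zeros n)

module Sequential (F : 𝔹 ⇉ 𝔹) (single : SingleValued F) (problem : IsProblem F) (em : ExcludedMiddle 0ℓ)
                  (c : Baire) (cᶠ : Fn nat) (computes-c : ∀ s → Computes cᶠ s c) (c∈dom : dom F c) where

  open Loops F single
  open Solvable problem
  open Classical em
  open Reductions F single problem

  argᶠ : Fn nat
  argᶠ = bindᶠ (askᶠ (pairᶜ (constᶜ 2) (constᶜ 0)))
    (caseᶠ #0 (cᶠ ∘ᶠ fstᶜ) (askᶠ (pairᶜ (constᶜ 2) (sucᶜ (fstᶜ ∘ᶜ fstᶜ +ᶜ fstᶜ ∘ᶜ fstᶜ)))))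

  -- Here the header numbers the simulated runs. It may start at 0, since no digit halts the loop of
  -- `F ^∞`; the end of a simulated run is recognised by the first digit of its point.
  headerᶠ pointᶠ : Fn ((nat ⊗ nat) ⊗ nat)
  headerᶠ = caseᶠ #1 (pureᶠ (sucᶜ (fstᶜ ∘ᶜ fstᶜ))) (pureᶠ (fstᶜ ∘ᶜ fstᶜ ∘ᶜ fstᶜ))
  pointᶠ  = caseᶠ #1 (askStateᶠ 3 (pairᶜ (sucᶜ (fstᶜ ∘ᶜ fstᶜ)) #0)) (applyPointᶠ ∘ᶠ fstᶜ)

  open Simulation headerᶠ pointᶠ argᶠ

  -- The final point of a run need not contain a question in `dom F`, but every move of the infinite
  -- loop needs an answer.
  arg : Baire → Baire
  arg u = caseℕ (u 0) c (λ _ → odds u)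

  Computes-arg : ∀ h u p → Computes argᶠ (state h u p) (arg u)
  Computes-arg h u p k = Yields-bind {Q = caseᶠ #0 (cᶠ ∘ᶠ fstᶜ) oddᶠ}
    (Yields-≡ {P = askᶠ (pairᶜ (constᶜ 2) (constᶜ 0))} (tuple-pair (contents h u p) 2 0)
      (Yields-ask {g = pairᶜ (constᶜ 2) (constᶜ 0)}))
    (at (u 0))
    where
    oddᶠ : Fn ((nat ⊗ nat) ⊗ nat)
    oddᶠ = askᶠ (pairᶜ (constᶜ 2) (sucᶜ (fstᶜ ∘ᶜ fstᶜ +ᶜ fstᶜ ∘ᶜ fstᶜ)))
    at : ∀ v → Yields (caseᶠ #0 (cᶠ ∘ᶠ fstᶜ) oddᶠ) (state h u p) (k , v) (caseℕ v c (λ _ → odds u) k)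
    at zero    = Yields-zero {g = #0} {cᶠ ∘ᶠ fstᶜ} {oddᶠ} refl
      (Yields-∘ {P = cᶠ} {g = fstᶜ} (computes-c (state h u p) k))
    at (suc n) = Yields-suc {g = #0} {cᶠ ∘ᶠ fstᶜ} {oddᶠ} {n = n} refl
      (Yields-≡ {P = oddᶠ} (tuple-pair (contents h u p) 2 (suc (k + k)))
        (Yields-ask {g = pairᶜ (constᶜ 2) (sucᶜ (fstᶜ ∘ᶜ fstᶜ +ᶜ fstᶜ ∘ᶜ fstᶜ))}))

  halted-↝ : ∀ h u p → u 0 ≡ 0 →
             config h u p (arg u) ↝ config (suc h) (component (suc h) p) p (arg (component (suc h) p))
  halted-↝ h u p e = let (x , f) = answerTo c∈dom in
    config-↝ {h} {suc h} {u} {component (suc h) p} {x = x}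
      (val-cong F (λ n → cong (λ m → caseℕ m c (λ _ → odds u) n) (sym e)) (λ _ → refl) f)
      (λ j → Yields-zero {g = #1} {pureᶠ (sucᶜ (fstᶜ ∘ᶜ fstᶜ))} {pureᶠ (fstᶜ ∘ᶜ fstᶜ ∘ᶜ fstᶜ)} e
        (Yields-pure {g = sucᶜ (fstᶜ ∘ᶜ fstᶜ)}))
      (λ j → Yields-zero {g = #1} {askStateᶠ 3 (pairᶜ (sucᶜ (fstᶜ ∘ᶜ fstᶜ)) #0)} {applyPointᶠ ∘ᶠ fstᶜ} e
        (Yields-askState {h} {u} {p} {x} 3 {J = pairᶜ (sucᶜ (fstᶜ ∘ᶜ fstᶜ)) #0} {(h , u 0) , j}))
      (Computes-arg (suc h) (component (suc h) p) p)

  running-↝ : ∀ h u p {r n} → u 0 ≡ suc n → u ↝ r → config h u p (arg u) ↝ config h r p (arg r)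
  running-↝ h u p {r} {n} e (step x f φ) =
    config-↝ {h} {h} {u} {r} {x = x}
      (val-cong F (λ k → cong (λ m → caseℕ m c (λ _ → odds u) k) (sym e)) (λ _ → refl) f)
      (λ j → Yields-suc {g = #1} {pureᶠ (sucᶜ (fstᶜ ∘ᶜ fstᶜ))} {pureᶠ (fstᶜ ∘ᶜ fstᶜ ∘ᶜ fstᶜ)} {n = n} e
        (Yields-pure {g = fstᶜ ∘ᶜ fstᶜ ∘ᶜ fstᶜ}))
      (λ j → Yields-suc {g = #1} {askStateᶠ 3 (pairᶜ (sucᶜ (fstᶜ ∘ᶜ fstᶜ)) #0)} {applyPointᶠ ∘ᶠ fstᶜ} {n = n} e
        (Yields-∘ {P = applyPointᶠ} {g = fstᶜ} (Yields-applyPoint {h} {u} {p} {x} {r} {nat ⊗ nat} {h , u 0} φ j)))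
      (Computes-arg h r p)

  -- A candidate is a configuration with header i at which the simulated run has halted.
  endᶠ testᶠ : Fn ((((nat ⊗ nat) ⊗ nat) ⊗ nat) ⊗ nat)
  endᶠ  = readᶠ 2 #2 (sndᶜ ∘ᶜ fstᶜ ∘ᶜ fstᶜ ∘ᶜ fstᶜ)
  testᶠ = caseᶠ #0 endᶠ (constᶜ 0)

  haltedᶠ : Fn (((nat ⊗ nat) ⊗ nat) ⊗ nat)
  haltedᶠ = caseᶠ (distanceᶜ #0 (fstᶜ ∘ᶜ fstᶜ ∘ᶜ fstᶜ)) (bindᶠ (readᶠ 2 #1 (constᶜ 0)) testᶠ) (constᶜ 0)

  candidateᶠ : Fn ((nat ⊗ nat) ⊗ nat)
  candidateᶠ = bindᶠ (readᶠ 0 #0 (constᶜ 0)) haltedᶠ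

  resultsᶠ : Fn nat
  resultsᶠ = searchᶠ candidateᶠ ∘ᶠ unpairᶜ idᶜ

  module _ {s p : Baire} {h : ℕ → ℕ} {u b : ℕ → Baire}
           (s≗ : s ≗ tuple (λ n → config (h n) (u n) p (b n))) (i j : ℕ) where

    private
      e : ∀ n k → s (pair n k) ≡ config (h n) (u n) p (b n) k
      e n k = trans (s≗ (pair n k)) (tuple-pair (λ n → config (h n) (u n) p (b n)) n k)

    test-sound : ∀ {v} n → (u n 0 ≡ 0 → u n j ≡ v) → Sound testᶠ s ((((i , j) , n) , h n) , u n 0) v
    test-sound {v} n v≡ = Sound-case {g = #0} {endᶠ} {constᶜ 0} {s} {(((i , j) , n) , h n) , u n 0} {v}
      (λ u≡0 → subst (λ w → Sound endᶠ s ((((i , j) , n) , h n) , u n 0) w) (v≡ u≡0)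
        (Yields.sound (Yields-read {2} {I = #2} {sndᶜ ∘ᶜ fstᶜ ∘ᶜ fstᶜ ∘ᶜ fstᶜ} {s} {(((i , j) , n) , h n) , u n 0} (e n))))
      (λ m _ → Sound-fail {_} {s} {a = (((((i , j) , n) , h n) , u n 0) , m)} {v})

    halted-sound : ∀ {v} n → (h n ≡ i → u n 0 ≡ 0 → u n j ≡ v) → Sound haltedᶠ s (((i , j) , n) , h n) v
    halted-sound {v} n v≡ = Sound-case {g = distanceᶜ #0 (fstᶜ ∘ᶜ fstᶜ ∘ᶜ fstᶜ)}
      {bindᶠ (readᶠ 2 #1 (constᶜ 0)) testᶠ} {constᶜ 0} {s} {((i , j) , n) , h n} {v}
      (λ h≡i → Sound-bind {P = readᶠ 2 #1 (constᶜ 0)} {testᶠ} {s} {((i , j) , n) , h n} {u n 0} {v}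
        (Yields.sound (Yields-read {2} {I = #1} {constᶜ 0} {s} {((i , j) , n) , h n} (e n)))
        (test-sound n (v≡ (distance≡0 (h n) i h≡i))))
      (λ m _ → Sound-fail {_} {s} {a = ((((i , j) , n) , h n) , m)} {v})

    candidate-sound : ∀ {v} n → (h n ≡ i → u n 0 ≡ 0 → u n j ≡ v) → Sound candidateᶠ s ((i , j) , n) v
    candidate-sound {v} n v≡ = Sound-bind {P = readᶠ 0 #0 (constᶜ 0)} {haltedᶠ} {s} {(i , j) , n} {h n} {v}
      (Yields.sound (Yields-read {0} {I = #0} {constᶜ 0} {s} {(i , j) , n} (e n)))
      (halted-sound n v≡)

    candidate-yields : ∀ n → h n ≡ i → u n 0 ≡ 0 → Yields candidateᶠ s ((i , j) , n) (u n j)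
    candidate-yields n h≡i u≡0 = Yields-bind {P = readᶠ 0 #0 (constᶜ 0)} {haltedᶠ}
      (Yields-read {0} {I = #0} {constᶜ 0} {a = (i , j) , n} (e n))
      (Yields-zero {P = bindᶠ (readᶠ 2 #1 (constᶜ 0)) testᶠ} {constᶜ 0}
        (trans (cong (λ m → distance m i) h≡i) (distance-refl i))
        (Yields-bind {P = readᶠ 2 #1 (constᶜ 0)} {testᶠ}
          (Yields-read {2} {I = #1} {constᶜ 0} {a = ((i , j) , n) , h n} (e n))
          (Yields-zero {g = #0} {endᶠ} {constᶜ 0} u≡0
            (Yields-read {2} {I = #2} {sndᶜ ∘ᶜ fstᶜ ∘ᶜ fstᶜ ∘ᶜ fstᶜ} {a = (((i , j) , n) , h n) , u n 0} (e n)))))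

    search-yields : ∀ {v} n → h n ≡ i → u n 0 ≡ 0 → (∀ n → h n ≡ i → u n 0 ≡ 0 → u n j ≡ v) →
                    Yields (searchᶠ candidateᶠ) s (i , j) v
    search-yields n h≡i u≡0 unique = Yields-search {R = candidateᶠ} n
      (Yields.defined (candidate-yields n h≡i u≡0)) (λ n → candidate-sound n (unique n))

  firstᶠ : Fn (nat ⊗ nat)
  firstᶠ = startᶠ (constᶜ 0) (askᶠ (pairᶜ (constᶜ 0) #0)) (askᶠ #0)

  startingᶠ : Fn nat
  startingᶠ = firstᶠ ∘ᶠ (constᶜ 0 ,ᶜ idᶜ)

  Yields-first : ∀ p k → Yields firstᶠ p (0 , k) (config 0 (component 0 p) p (arg (component 0 p)) k)
  Yields-first p = Yields-start {H = constᶜ 0} {askᶠ (pairᶜ (constᶜ 0) #0)} {askᶠ #0} {s = p} {a = 0}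
    {u = component 0 p} {p = p} {a′ = arg (component 0 p)}
    (λ j → Yields-ask {g = pairᶜ (constᶜ 0) #0} {a = 0 , j}) (λ j → Yields-ask {g = #0} {a = 0 , j})
    (Computes-arg 0 (component 0 p) p)

  Computes-starting : ∀ p → Computes startingᶠ p (config 0 (component 0 p) p (arg (component 0 p)))
  Computes-starting p k = Yields-∘ {P = firstᶠ} {g = constᶜ 0 ,ᶜ idᶜ} (Yields-first p k)

  module Runs (p : Baire) (d : ∀ i → dom (F ^◇) (component i p)) where

    run-of : ℕ → ℕ → Baire
    run-of i = trajectory (component i p)

    halt : ℕ → ℕ
    halt i = proj₁ (Halting.halts (d i))

    ends : ℕ → Baire
    ends i = run-of i (halt i)

    halt-stops : ∀ i → run-of i (halt i) 0 ≡ 0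
    halt-stops i = proj₁ (proj₂ (Halting.halts (d i)))

    halt-least : ∀ i j → j < halt i → run-of i j 0 ≢ 0
    halt-least i = proj₂ (proj₂ (Halting.halts (d i)))

    -- A position `(i , m)` stands for run `i` after `m` moves; passing from a halted run to the
    -- next takes a step of its own.
    move : ℕ × ℕ → ℕ × ℕ
    move (i , m) = caseℕ (run-of i m 0) (suc i , 0) (λ _ → i , suc m)

    position : ℕ → ℕ × ℕ
    position zero    = 0 , 0
    position (suc n) = move (position n)

    Unhalted : ℕ × ℕ → Set
    Unhalted (i , m) = ∀ j → j < m → run-of i j 0 ≢ 0

    -- This invariant ensures that the loop imitates only genuine moves of the runs, and that a
    -- halted position `(i , m)` has `m ≡ halt i`. The search may thus return any candidate with
    -- header `i`.
    unhalted : ∀ n → Unhalted (position n)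
    unhalted zero    _ ()
    unhalted (suc n) = preserve (position n) (unhalted n)
      where
      preserve : ∀ z → Unhalted z → Unhalted (move z)
      preserve (i , m) ne with run-of i m 0 in eq
      ... | zero  = λ _ ()
      ... | suc _ = ∀<-suc {λ j → run-of i j 0 ≢ 0} ne (λ e → 1+n≢0 (trans (sym eq) e))

    configAt : ℕ × ℕ → Baire
    configAt (i , m) = config i (run-of i m) p (arg (run-of i m))

    configAt-↝ : ∀ z → Unhalted z → configAt z ↝ configAt (move z)
    configAt-↝ (i , m) ne = at (run-of i m 0) refl
      where
      at : ∀ v → run-of i m 0 ≡ v → configAt (i , m) ↝ configAt (caseℕ v (suc i , 0) (λ _ → i , suc m))
      at zero    e = halted-↝ i (run-of i m) p e
      at (suc v) e = running-↝ i (run-of i m) p e (Halting.isRun (d i) (suc m)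
        (∀<-suc {λ j → run-of i j 0 ≢ 0} ne (λ c → 1+n≢0 (trans (sym e) c))) m ≤-refl)

    passes : ∀ i n → position n ≡ (i , 0) → ∀ m → m ≤ halt i → position (m + n) ≡ (i , m)
    passes i n e zero    l = e
    passes i n e (suc m) l = trans (cong move (passes i n e m (<⇒≤ l))) (at (run-of i m 0) (halt-least i m l))
      where
      at : ∀ v → v ≢ 0 → caseℕ v (suc i , 0) (λ _ → i , suc m) ≡ (i , suc m)
      at zero    ne = ⊥-elim (ne refl)
      at (suc v) _  = refl

    -- Run `i` occupies `suc (halt i)` steps of the loop, the last of them being the passage to the
    -- next run; so each run gets its turn.
    arrives : ∀ i → ∃[ n ] position n ≡ (i , 0)
    arrives zero    = 0 , refl
    arrives (suc i) = let (n , e) = arrives i in suc (halt i + n) ,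
      trans (cong move (passes i n e (halt i) ≤-refl))
            (cong (λ v → caseℕ v (suc i , 0) (λ _ → i , suc (halt i))) (halt-stops i))

    halt-unique : ∀ i m → Unhalted (i , m) → run-of i m 0 ≡ 0 → m ≡ halt i
    halt-unique i m ne e with <-cmp m (halt i)
    ... | tri< l _ _ = ⊥-elim (halt-least i m l e)
    ... | tri≈ _ k _ = k
    ... | tri> _ _ l = ⊥-elim (ne (halt i) l (halt-stops i))

    private
      points : ℕ → Baire
      points n = uncurry run-of (position n)

      found : ∀ i → ∃[ n ] proj₁ (position n) ≡ i × points n 0 ≡ 0
      found i =
        let (n , arrived) = arrives i
            at            = passes i n arrived (halt i) ≤-refl
        in halt i + n , cong proj₁ at , trans (cong (λ z → uncurry run-of z 0) at) (halt-stops i)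

      unique : ∀ i j n → proj₁ (position n) ≡ i → points n 0 ≡ 0 → points n j ≡ ends i j
      unique i j n = at (position n) (unhalted n)
        where
        at : ∀ z → Unhalted z → proj₁ z ≡ i → uncurry run-of z 0 ≡ 0 →
             uncurry run-of z j ≡ ends i j
        at (_ , m) ne refl stop = cong (λ m → run-of i m j) (halt-unique i m ne stop)

    Computes-results : ∀ {s} → s ≗ tuple (configAt ∘ position) → Computes resultsᶠ s (tuple ends)
    Computes-results {s} e = Computes-tuple {searchᶠ candidateᶠ} {s} {ends} yields-end
      where
      yields-end : ∀ i j → Yields (searchᶠ candidateᶠ) s (i , j) (ends i j)
      yields-end i j = let (n , h≡i , u≡0) = found i in
        search-yields {s} {p} {proj₁ ∘ position} {points} {arg ∘ points} e i j n h≡i u≡0 (unique i j)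

    private
      configs-↝ : ∀ n → configAt (position n) ↝ configAt (position (suc n))
      configs-↝ n = configAt-↝ (position n) (unhalted n)

    starting∈dom : dom (F ^∞) (configAt (0 , 0))
    starting∈dom = ∞-dom (configAt ∘ position) configs-↝

    starting-results : ∀ {r y} → r ≗ y → val (F ^∞) (configAt (0 , 0)) y →
                       Computes resultsᶠ r (tuple ends)
    starting-results e v = Computes-results (λ k → trans (e k) (∞-value (configAt ∘ position) configs-↝ v k))

    ends-val : ∀ i → val (F ^◇) (component i p) (run-of i (halt i))
    ends-val i = SuccessfulRun.◇-val (run-of i) (halt i)
      (Halting.isRun (d i) (halt i) (halt-least i)) (halt-stops i) (halt-least i)

  ◇≤∞ : parallelization (F ^◇) ≤sW F ^∞
  ◇≤∞ = graphOf resultsᶠ , graphOf startingᶠ , graphOf-computable resultsᶠ , graphOf-computable startingᶠ , reduce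
    where
    reduce : ∀ G → G ⊢ F ^∞ → graphOf resultsᶠ ∘ᵖ G ∘ᵖ graphOf startingᶠ ⊢ parallelization (F ^◇)
    reduce G realizes p x p≗x dx =
      let (r , g , y , r≗y , v) = realizes (configAt (0 , 0)) (configAt (0 , 0)) (λ _ → refl) starting∈dom
      in tuple ends ,
         (r , (configAt (0 , 0) , Computes-starting p , g) , starting-results r≗y v) ,
         ends , tuple-pair ends , λ i → val-cong (F ^◇) (p≗x i) (λ _ → refl) (ends-val i)
      where
      open Runs p (λ i → dom-cong (F ^◇) (sym ∘ p≗x i) (dx i))

-- The preprocessing `K` of the reduction from `idᵐ`, applied to the zero sequence, gives such a
-- point. It lies in `dom F` because the reduction must also succeed with the graph of `F` as
-- realizer, which is undefined elsewhere; single-valuedness makes this graph a partial function.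
computablePoint : (F : 𝔹 ⇉ 𝔹) → SingleValued F → IsProblem F → Pointed F →
                  ∃[ c ] dom F c × Σ (Fn nat) λ P → ∀ s → Computes P s c
computablePoint F single (G , G⊢F) (H , K , _ , (φ , φ-computable , _ , sup) , reduce) =
  let (_ , (_ , (_ , (c , K0≡c , f) , _) , _) , _) = reduce solution solves (λ _ → 0) (λ _ → 0) (λ _ → refl) tt
  in c , val⇒dom F f , zero-outputᶠ P , Computes-zero-output P (sup (λ _ → 0) c K0≡c)
  where
  P = record { run = φ ; computable = φ-computable }
  solution : PartialFunction
  solution = record { graph = val F ; graph-cong = val-cong F ; graph-unique = single }
  solves : solution ⊢ F
  solves p x p≗x d =
    let (_ , _ , y , _ , f) = G⊢F p x p≗x d in y , val-cong F (sym ∘ p≗x) (λ _ → refl) f , y , (λ _ → refl) , f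

corollary21 : ExcludedMiddle 0ℓ →
    (F : 𝔹 ⇉ 𝔹) → IsProblem F → SingleValued F → Pointed F →
    (F ^∞ ≡sW F ^ω) × (F ^ω ≡sW parallelization (F ^◇))
corollary21 em F problem single pointed =
  (∞≤ω , ≤sW-trans {f = F ^ω} {parallelization (F ^◇)} {F ^∞} ω≤◇ ◇≤∞) ,
  (ω≤◇ , ≤sW-trans {f = parallelization (F ^◇)} {F ^∞} {F ^ω} ◇≤∞ ∞≤ω)
  where
  open Reductions F single problem
  open Unfolding using (∞≤ω)
  open Countdown using (ω≤◇)
  point = computablePoint F single problem pointed
  open Sequential F single problem em
    (proj₁ point) (proj₁ (proj₂ (proj₂ point))) (proj₂ (proj₂ (proj₂ point))) (proj₁ (proj₂ point))
    using (◇≤∞)
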